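{- Let $e_1,e_2,e_3$ be integers with $2\le e_1,e_2,e_3\le 50$, let $v:=e_1e_2e_3$, and let $k$ be an integer with $1<k<v$. Put $d:=\gcd(e_1-1,e_2-1,e_3-1)$, $y_1:=1+\frac{k-1}{v-1}(e_1-1)$, $y_2:=1+\frac{k-1}{v-1}(e_1e_2-1)$. Then the conditions (1) $v-1$ divides $(k-1)d$; (2) $y_1$ is an integer dividing $(e_2-1)e_1/d$; (3) $y_2$ is an integer dividing $(e_3-1)e_1e_2/d$ all hold, and the incidence structure $\mathscr{D}^{\rm ft}((e_1,e_2,e_3);k)$ (defined in the context) is a flag-transitive, $3$-chain-imprimitive $2$-design, if and only if $(e_1,e_2,e_3,k)$ is one of the following $57$ tuples: $(3,5,17,128)$, $(3,5,33,248)$, $(3,5,49,368)$, $(3,9,29,392)$, $(3,13,41,800)$, $(4,4,10,54)$, $(4,4,19,102)$, $(4,4,28,150)$, $(4,4,37,198)$, $(4,4,46,246)$, $(4,7,16,150)$, $(4,7,31,290)$, $(4,7,46,430)$, $(4,10,22,294)$, $(4,10,43,574)$, $(4,13,28,486)$, $(4,16,34,726)$, $(4,19,40,1014)$, $(4,22,46,1350)$, $(5,7,37,648)$, $(5,9,17,192)$, $(5,9,33,372)$, $(5,9,49,552)$, $(6,6,11,80)$, $(6,6,21,152)$, $(6,6,26,375)$, $(6,6,31,224)$, $(6,6,41,296)$, $(6,11,36,476)$, $(6,11,46,1215)$, $(6,16,26,500)$, $(6,26,41,1280)$, $(7,10,37,864)$, $(7,25,37,1080)$, $(8,8,36,330)$,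 $(8,8,50,1372)$, $(8,15,22,378)$, $(8,15,43,738)$, $(8,36,50,2058)$, $(9,5,17,192)$, $(9,5,33,372)$, $(9,5,49,552)$, $(9,9,29,588)$, $(9,13,41,1200)$, $(10,7,37,864)$, $(10,10,28,312)$, $(10,28,37,1152)$, $(11,16,46,1620)$, $(12,12,34,891)$, $(15,8,22,378)$, $(15,8,43,738)$, $(15,8,50,1715)$, $(16,6,26,500)$, $(16,11,46,1620)$, $(25,7,37,1080)$, $(28,10,37,1152)$, $(36,8,50,2058)$.
   Context: Let $\mathscr{P}=\mathbb{Z}_{e_1}\times\mathbb{Z}_{e_2}\times\mathbb{Z}_{e_3}$, with $\mathbb{Z}_{e}=\{0,1,\dots,e-1\}$. For $0\le i\le 3$ let $\mathscr{C}_i$ be the partition of $\mathscr{P}$ in which two points lie in the same class iff their $j$-th coordinates agree for all $j>i$. Let $G=S_{e_1}\wr S_{e_2}\wr S_{e_3}$, the group of all permutations of $\mathscr{P}$ leaving invariant each of $\mathscr{C}_0,\dots,\mathscr{C}_3$. When conditions (1)–(3) hold, set $y_0=1$, $y_3=k$; the ratios $y_i/y_{i-1}$ are then integers with $1<y_i/y_{i-1}<e_i$, and $\mathscr{D}^{\rm ft}((e_1,e_2,e_3);k):=(\mathscr{P},B^G)$, where $B=\{(\delta_1,\delta_2,\delta_3)\in\mathscr{P}: 0\le\delta_i\le \frac{y_i}{y_{i-1}}-1 \text{ for } i=1,2,3\}$ and $B^G=\{B^g: g\in G\}$. A $2$-design is a pair (points, nonempty set of blocks) in which all blocks are point-subsets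 of the same size and any two distinct points lie in the same number of blocks. It is flag-transitive and $3$-chain-imprimitive (here with respect to $G$ and the chain $\mathscr{C}_0,\dots,\mathscr{C}_3$) if $G$ consists of automorphisms, is transitive on the flags (incident point-block pairs), is transitive on points, and leaves each $\mathscr{C}_i$ invariant. -}

module Defs where

open import Data.Fin.Base using (Fin; zero; suc; toℕ; inject₁)
open import Data.Integer.Base using (+_)
import Data.Integer.Divisibility as ℤ
open import Data.List.Base using (List; []; _∷_)
open import Data.Nat.Base as ℕ using (ℕ; zero; suc; NonZero; _≤_; _*_; _∸_; s≤s)
open import Data.Nat.Divisibility using (_∣_)
open import Data.Nat.DivMod using () renaming (_/_ to _/ₙ_)
open import Data.Nat.GCD using (gcd; gcd[m,n]≢0)
import Data.Nat.Properties as ℕ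
open import Data.Product.Base using (Σ; ∃; ∃-syntax; _×_; _,_; proj₁)
open import Data.Rational.Base as ℚ using (ℚ; 1ℚ; _/_; _÷_)
import Data.Rational.Properties as ℚ
open import Data.Sum.Base using (inj₁)
open import Data.Vec.Base using ([]; _∷_; lookup)
open import Function.Bundles using (Inverse; _↔_; _⇔_)
open import Level using (0ℓ; _⊔_)
open import Relation.Binary.Bundles using (Setoid)
open import Relation.Binary.Core using (Rel)
open import Relation.Binary.PropositionalEquality using (_≡_; _≢_; setoid)
import Relation.Binary.Construct.On as On
open import Relation.Unary using (Pred; _∈_; _≐_)
open import Relation.Unary.Relation.Binary.Equality using (≐-setoid)

-- Elements of the subset are identified when their underlying elements are
-- equal, so membership proofs do not affect the count.
HasCardinality : ∀ {a ℓ p} (S : Setoid a ℓ) → Pred (Setoid.Carrier S) p → ℕ → Set (a ⊔ ℓ ⊔ p)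
HasCardinality S X n =
  Inverse (On.setoid {B = Σ (Setoid.Carrier S) X} S proj₁) (setoid (Fin n))

-- Blocks are subsets of the point set, equal when they have the same elements;
-- the block set 𝓑 is a predicate on subsets.
record IncidenceStructure : Set₁ where
  field
    Point : Set
    𝓑     : Pred (Pred Point 0ℓ) 0ℓ

_^_ : ∀ {P : Set} → Pred P 0ℓ → P ↔ P → Pred P 0ℓ
(X ^ g) q = ∃[ p ] p ∈ X × Inverse.to g p ≡ q

record Is2Design (𝒟 : IncidenceStructure) : Set₁ where
  open IncidenceStructure 𝒟
  field
    nonempty  : ∃ 𝓑
    uniform   : ∃[ k ] ∀ X → X ∈ 𝓑 → HasCardinality (setoid Point) X k
    balanced  : ∃[ l ] ∀ p q → p ≢ q →
                HasCardinality (≐-setoid Point 0ℓ) (λ X → X ∈ 𝓑 × p ∈ X × q ∈ X) l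

-- Partitions are given by their equivalence relations.
LeavesInvariant : ∀ {P : Set} → P ↔ P → Rel P 0ℓ → Set
LeavesInvariant g _∼_ = ∀ p q → (p ∼ q) ⇔ (Inverse.to g p ∼ Inverse.to g q)

record IsFlagTransitiveChainImprimitive
  (𝒟 : IncidenceStructure)
  (G : Pred (IncidenceStructure.Point 𝒟 ↔ IncidenceStructure.Point 𝒟) 0ℓ)
  {n : ℕ} (𝒞 : Fin n → Rel (IncidenceStructure.Point 𝒟) 0ℓ) : Set₁ where
  open IncidenceStructure 𝒟
  field
    automorphisms   : ∀ g → g ∈ G → ∀ X → (X ∈ 𝓑) ⇔ ((X ^ g) ∈ 𝓑)
    flagTransitive  : ∀ p X q Y → X ∈ 𝓑 → p ∈ X → Y ∈ 𝓑 → q ∈ Y →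
                      ∃[ g ] g ∈ G × Inverse.to g p ≡ q × (X ^ g) ≐ Y
    pointTransitive : ∀ p q → ∃[ g ] g ∈ G × Inverse.to g p ≡ q
    chainInvariant  : ∀ g → g ∈ G → ∀ i → LeavesInvariant g (𝒞 i)

IsIntegerDividing : ℚ → ℕ → Set
IsIntegerDividing y n = ∃[ z ] y ≡ z / 1 × z ℤ.∣ + n

module Parameters (e₁ e₂ e₃ k : ℕ)
  (2≤e₁ : 2 ≤ e₁) (2≤e₂ : 2 ≤ e₂) (2≤e₃ : 2 ≤ e₃) where

  v d : ℕ
  v = e₁ * e₂ * e₃
  d = gcd (e₁ ∸ 1) (gcd (e₂ ∸ 1) (e₃ ∸ 1))

  private instance
    d≢0 : NonZero d
    d≢0 = ℕ.≢-nonZero (gcd[m,n]≢0 (e₁ ∸ 1) _ (inj₁ (ℕ.m>n⇒m∸n≢0 2≤e₁)))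

    v∸1≢0 : NonZero (v ∸ 1)
    v∸1≢0 = ℕ.≢-nonZero (ℕ.m>n⇒m∸n≢0
      (ℕ.≤-trans (s≤s (s≤s ℕ.z≤n))
        (ℕ.*-mono-≤ (ℕ.*-mono-≤ 2≤e₁ 2≤e₂) 2≤e₃)))

  y : Fin 4 → ℚ
  y zero                   = 1ℚ
  y (suc zero)             = 1ℚ ℚ.+ (+ (k ∸ 1) / (v ∸ 1)) ℚ.* (+ (e₁ ∸ 1) / 1)
  y (suc (suc zero))       = 1ℚ ℚ.+ (+ (k ∸ 1) / (v ∸ 1)) ℚ.* (+ (e₁ * e₂ ∸ 1) / 1)
  y (suc (suc (suc zero))) = + k / 1

  -- The natural-number quotients are exact, since d divides e₂ ∸ 1 and e₃ ∸ 1.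
  record Conditions : Set where
    field
      condition₁ : (v ∸ 1) ∣ ((k ∸ 1) * d)
      condition₂ : IsIntegerDividing (y (suc zero)) (((e₂ ∸ 1) * e₁) /ₙ d)
      condition₃ : IsIntegerDividing (y (suc (suc zero))) (((e₃ ∸ 1) * e₁ * e₂) /ₙ d)

  private
    1+ab-nonZero : ∀ m n o .{{_ : NonZero n}} →
                   ℚ.NonZero (1ℚ ℚ.+ (+ m / n) ℚ.* (+ o / 1))
    1+ab-nonZero m n o = ℚ.pos⇒nonZero (1ℚ ℚ.+ a ℚ.* b) {{ℚ.pos+nonNeg⇒pos 1ℚ (a ℚ.* b)
      {{ℚ.nonNeg*nonNeg⇒nonNeg a {{ℚ.normalize-nonNeg m n}}
                               b {{ℚ.normalize-nonNeg o 1}}}}}}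
      where a = + m / n
            b = + o / 1

    y≢0 : ∀ i → ℚ.NonZero (y (inject₁ i))
    y≢0 zero             = _
    y≢0 (suc zero)       = 1+ab-nonZero (k ∸ 1) (v ∸ 1) (e₁ ∸ 1)
    y≢0 (suc (suc zero)) = 1+ab-nonZero (k ∸ 1) (v ∸ 1) (e₁ * e₂ ∸ 1)

  ratio : Fin 3 → ℚ
  ratio i = (y (suc i) ÷ y (inject₁ i)) {{y≢0 i}}

  e : Fin 3 → ℕ
  e = lookup (e₁ ∷ e₂ ∷ e₃ ∷ [])

  𝒫 : Set
  𝒫 = Fin e₁ × Fin e₂ × Fin e₃

  -- Coordinates (like e and ratio) are indexed from 0: coord j is the
  -- (j + 1)-st coordinate.
  coord : (j : Fin 3) → 𝒫 → Fin (e j)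
  coord zero             (δ₁ , δ₂ , δ₃) = δ₁
  coord (suc zero)       (δ₁ , δ₂ , δ₃) = δ₂
  coord (suc (suc zero)) (δ₁ , δ₂ , δ₃) = δ₃

  𝒞 : Fin 4 → Rel 𝒫 0ℓ
  𝒞 i p q = ∀ j → toℕ i ℕ.< suc (toℕ j) → coord j p ≡ coord j q

  G : Pred (𝒫 ↔ 𝒫) 0ℓ
  G g = ∀ i → LeavesInvariant g (𝒞 i)

  B : Pred 𝒫 0ℓ
  B δ = ∀ i → (+ toℕ (coord i δ) / 1) ℚ.≤ ratio i ℚ.- 1ℚ

  -- Defined for all parameters, whether or not the conditions hold.
  𝒟ᶠᵗ : IncidenceStructure
  𝒟ᶠᵗ = record
    { Point = 𝒫
    ; 𝓑     = λ X → ∃[ g ] g ∈ G × X ≐ (B ^ g)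
    }

tuples : List (ℕ × ℕ × ℕ × ℕ)
tuples =
  (3 , 5 , 17 , 128) ∷ (3 , 5 , 33 , 248) ∷ (3 , 5 , 49 , 368) ∷ (3 , 9 , 29 , 392) ∷
  (3 , 13 , 41 , 800) ∷ (4 , 4 , 10 , 54) ∷ (4 , 4 , 19 , 102) ∷ (4 , 4 , 28 , 150) ∷
  (4 , 4 , 37 , 198) ∷ (4 , 4 , 46 , 246) ∷ (4 , 7 , 16 , 150) ∷ (4 , 7 , 31 , 290) ∷
  (4 , 7 , 46 , 430) ∷ (4 , 10 , 22 , 294) ∷ (4 , 10 , 43 , 574) ∷ (4 , 13 , 28 , 486) ∷
  (4 , 16 , 34 , 726) ∷ (4 , 19 , 40 , 1014) ∷ (4 , 22 , 46 , 1350) ∷ (5 , 7 , 37 , 648) ∷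
  (5 , 9 , 17 , 192) ∷ (5 , 9 , 33 , 372) ∷ (5 , 9 , 49 , 552) ∷ (6 , 6 , 11 , 80) ∷
  (6 , 6 , 21 , 152) ∷ (6 , 6 , 26 , 375) ∷ (6 , 6 , 31 , 224) ∷ (6 , 6 , 41 , 296) ∷
  (6 , 11 , 36 , 476) ∷ (6 , 11 , 46 , 1215) ∷ (6 , 16 , 26 , 500) ∷ (6 , 26 , 41 , 1280) ∷
  (7 , 10 , 37 , 864) ∷ (7 , 25 , 37 , 1080) ∷ (8 , 8 , 36 , 330) ∷ (8 , 8 , 50 , 1372) ∷
  (8 , 15 , 22 , 378) ∷ (8 , 15 , 43 , 738) ∷ (8 , 36 , 50 , 2058) ∷ (9 , 5 , 17 , 192) ∷
  (9 , 5 , 33 , 372) ∷ (9 , 5 , 49 , 552) ∷ (9 , 9 , 29 , 588) ∷ (9 , 13 , 41 , 1200) ∷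
  (10 , 7 , 37 , 864) ∷ (10 , 10 , 28 , 312) ∷ (10 , 28 , 37 , 1152) ∷ (11 , 16 , 46 , 1620) ∷
  (12 , 12 , 34 , 891) ∷ (15 , 8 , 22 , 378) ∷ (15 , 8 , 43 , 738) ∷ (15 , 8 , 50 , 1715) ∷
  (16 , 6 , 26 , 500) ∷ (16 , 11 , 46 , 1620) ∷ (25 , 7 , 37 , 1080) ∷ (28 , 10 , 37 , 1152) ∷
  (36 , 8 , 50 , 2058) ∷ []

{-# OPTIONS --safe #-}
module Submission where

-- If conditions (1)–(3) hold, then with d = gcd (e₁ - 1) (e₂ - 1) (e₃ - 1) the number
-- m = (k - 1) d / (v - 1) is an integer with 0 < m < d, so (e₁ , e₂ , e₃ , k) is determined by d,
-- m and the aᵢ = (eᵢ - 1) / d, and conditions (2) and (3) become divisibilities between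
-- polynomials in these few small numbers: a finite search.
--
-- Conversely, put xᵢ = yᵢ / yᵢ₋₁. A subset of 𝒫 is an image of B under G iff it arises by choosing
-- x₃ classes of 𝒞₂, in each of them x₂ classes of 𝒞₁, and in each of these x₁ points. Counting
-- such subsets one level at a time, the number containing two given points depends only on the
-- finest partition in which they are equivalent, and consecutive values agree exactly because
-- yᵢ - 1 is proportional to e₁⋯eᵢ - 1. Flag-transitivity needs only products of three
-- transpositions, which preserve B when they move points inside it.

open import Defs
open import Algebra.Properties.CommutativeMonoid.Sum as Sum using ()
open import Data.Bool.Base using (Bool; true; false; _∧_; T; if_then_else_)
open import Data.Bool.Properties using (T?; T-∧; T-≡; ∧-comm; ∧-identityʳ; ⇔→≡)
open import Data.Fin.Base using (Fin; zero; suc; toℕ; fromℕ<; inject≤; punchOut)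
open import Data.Fin.Permutation
  using (Permutation′; _⟨$⟩ʳ_; _⟨$⟩ˡ_; permutation; transpose; insert; lift₀; inverseˡ; inverseʳ)
import Data.Fin.Permutation as Perm
import Data.Fin.Permutation.Components as Components
import Data.Fin.Properties as Fin
open import Data.Integer.Base as ℤ using (+_)
import Data.Integer.Properties as ℤ
import Data.Integer.Tactic.RingSolver as ℤ
open import Data.List.Base
  using (List; []; _∷_; [_]; _++_; map; length; filterᵇ; cartesianProductWith)
import Data.List.Base as List
open import Data.List.Membership.Propositional using (_∈_; _∉_)
open import Data.List.Membership.Propositional.Properties
  using (∈-++⁺ˡ; ∈-++⁺ʳ; ∈-++⁻; ∈-map⁺; ∈-map⁻; ∈-cartesianProductWith⁺; ∈-cartesianProductWith⁻;
         ∈-filter⁺; ∈-filter⁻; ∈-lookup)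
open import Data.List.Membership.Propositional.Properties.WithK using (unique⇒irrelevant)
open import Data.List.Properties using (length-++; filter-++)
open import Data.List.Relation.Unary.All as All using (All; [])
open import Data.List.Relation.Unary.AllPairs using ([]; _∷_)
open import Data.List.Relation.Unary.Any using (here; there; index)
open import Data.List.Relation.Unary.Any.Properties using (lookup-index)
open import Data.List.Relation.Unary.Unique.Propositional using (Unique)
open import Data.List.Relation.Unary.Unique.Propositional.Properties
  using (map⁺; ++⁺; cartesianProductWith⁺; filter⁺)
open import Data.Nat.Base hiding (_^_)
open import Data.Nat.Divisibility
open import Data.Nat.DivMod using (m*n/n≡m; /-monoˡ-≤)
open import Data.Nat.GCD using (gcd; gcd[m,n]∣m; gcd[m,n]∣n; gcd[m,n]≢0)
open import Data.Nat.Properties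
open import Data.Nat.Tactic.RingSolver using (solve-∀)
open import Data.Product.Base using (Σ; Σ-syntax; ∃; ∃-syntax; _×_; _,_; proj₁; proj₂)
open import Data.Product.Function.NonDependent.Propositional using (_×-↔_)
open import Data.Product.Properties using (≡-dec)
open import Data.Rational.Base as ℚ using (1ℚ; _÷_; toℚᵘ)
import Data.Rational.Properties as ℚ
open import Data.Rational.Unnormalised.Base as ℚᵘ using (mkℚᵘ; *≡*; *≤*; 1ℚᵘ; _≃_)
import Data.Rational.Unnormalised.Properties as ℚᵘ
open import Data.Sum.Base using (inj₁; inj₂)
open import Data.Unit.Base using (⊤; tt)
open import Data.Vec.Base using (Vec; []; _∷_; lookup; tabulate; replicate)
open import Data.Vec.Properties
  using (∷-injectiveʳ; lookup-replicate; lookup∘tabulate; tabulate∘lookup; tabulate-cong)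
open import Function.Base using (_∘_; const)
open import Function.Bundles using (_↔_; _⇔_; Inverse; Equivalence; mk⇔; mk↔ₛ′)
open import Function.Properties.Inverse using (↔-refl; ↔-sym; ↔-trans)
open import Level using (0ℓ)
open import Relation.Binary.PropositionalEquality hiding ([_])
open import Relation.Nullary using (¬_; Dec; yes; no; contradiction)
open import Relation.Nullary.Decidable using (toWitness; map′; _→-dec_; _×-dec_; dec-true)
open import Relation.Unary using (Pred; _≐_)
open import Relation.Unary.Relation.Binary.Equality using (≐-setoid)

open Sum +-0-commutativeMonoid using (sum; sum-permute)
open Equivalence using () renaming (to to ⇒; from to ⇐)

private variable
  A D E : Set

-- Counting list entries by Boolean predicates

count : (A → Bool) → List A → ℕ
count φ xs = length (filterᵇ φ xs)

count-++ : ∀ (φ : A → Bool) xs ys → count φ (xs ++ ys) ≡ count φ xs + count φ ys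
count-++ φ xs ys = trans (cong length (filter-++ (T? ∘ φ) xs ys)) (length-++ (filterᵇ φ xs))

count-map : ∀ (φ : D → Bool) (f : A → D) xs → count φ (map f xs) ≡ count (φ ∘ f) xs
count-map φ f [] = refl
count-map φ f (x ∷ xs) with φ (f x)
... | true  = cong suc (count-map φ f xs)
... | false = count-map φ f xs

count-cong : ∀ {φ ψ : A → Bool} → (∀ x → φ x ≡ ψ x) → ∀ xs → count φ xs ≡ count ψ xs
count-cong eq [] = refl
count-cong {φ = φ} {ψ} eq (x ∷ xs) with φ x | ψ x | eq x
... | true  | true  | refl = cong suc (count-cong eq xs)
... | false | false | refl = count-cong eq xs

count-none : ∀ (xs : List A) → count (const false) xs ≡ 0
count-none []       = refl
count-none (x ∷ xs) = count-none xs

count-cartesianProductWith : ∀ (φ : E → Bool) (χ : A → Bool) (ψ : D → Bool) (f : A → D → E) →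
  (∀ x y → φ (f x y) ≡ χ x ∧ ψ y) →
  ∀ xs ys → count φ (cartesianProductWith f xs ys) ≡ count χ xs * count ψ ys
count-cartesianProductWith φ χ ψ f eq []       ys = refl
count-cartesianProductWith φ χ ψ f eq (x ∷ xs) ys = begin
  count φ (map (f x) ys ++ cartesianProductWith f xs ys)
    ≡⟨ count-++ φ (map (f x) ys) _ ⟩
  count φ (map (f x) ys) + count φ (cartesianProductWith f xs ys)
    ≡⟨ cong₂ _+_ (trans (count-map φ (f x) ys) (count-cong (eq x) ys))
                 (count-cartesianProductWith φ χ ψ f eq xs ys) ⟩
  count (λ y → χ x ∧ ψ y) ys + count χ xs * count ψ ys
    ≡⟨ row ⟩
  count χ (x ∷ xs) * count ψ ys ∎
  where
  open ≡-Reasoning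
  row : count (λ y → χ x ∧ ψ y) ys + count χ xs * count ψ ys ≡ count χ (x ∷ xs) * count ψ ys
  row with χ x
  ... | true  = refl
  ... | false = cong (_+ count χ xs * count ψ ys) (count-none ys)

-- Weighted binomial coefficients

shift : A → (ℕ → A) → ℕ → A
shift a f zero    = a
shift a f (suc x) = f x

-- The number of words of length n over an alphabet with f + 1 letters
-- having x letters different from a fixed one, i.e. (n C x) f ^ x.
words : ℕ → ℕ → ℕ → ℕ
words f zero    zero    = 1
words f zero    (suc x) = 0
words f (suc n) x       = words f n x + f * shift 0 (words f n) x

-- Weighted form of x (n C x) = n ((n-1) C (x-1)): mark one of the nonfixed letters in a word, or
-- choose its position and value first. The proof itself is an induction along the Pascal-type
-- recurrence.
words-absorption : ∀ f n x → suc x * words f (suc n) (suc x) ≡ suc n * (f * words f n x)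
words-absorption f zero    zero    = refl
words-absorption f zero    (suc x) rewrite *-zeroʳ f | *-zeroʳ x = refl
words-absorption f (suc n) x = begin
  suc x * (words f (suc n) (suc x) + f * words f (suc n) x)
    ≡⟨ *-distribˡ-+ (suc x) (words f (suc n) (suc x)) _ ⟩
  suc x * words f (suc n) (suc x) + suc x * (f * words f (suc n) x)
    ≡⟨ cong (_+ suc x * (f * words f (suc n) x)) (words-absorption f n x) ⟩
  suc n * (f * words f n x) + suc x * (f * words f (suc n) x)
    ≡⟨ lemma x ⟩
  suc (suc n) * (f * words f (suc n) x) ∎
  where
  open ≡-Reasoning
  alg₁ : ∀ n f a → suc n * (f * a) + 1 * (f * (a + f * 0)) ≡ suc (suc n) * (f * (a + f * 0))
  alg₁ = solve-∀
  alg₂ : ∀ n f p q x → suc n * (f * p) + suc x * (f * q) ≡ f * (suc n * p + x * q) + f * q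
  alg₂ = solve-∀
  alg₃ : ∀ n f p q →
    f * (suc n * p + suc n * (f * q)) + f * (p + f * q) ≡ suc (suc n) * (f * (p + f * q))
  alg₃ = solve-∀
  lemma : ∀ x → suc n * (f * words f n x) + suc x * (f * words f (suc n) x) ≡
                suc (suc n) * (f * words f (suc n) x)
  lemma zero    = alg₁ n f (words f n 0)
  -- The identity for `n` enters a second time, at one letter fewer, to trade the factor `suc x` for
  -- `suc n`.
  lemma (suc x) = begin
    suc n * (f * words f n (suc x)) + suc (suc x) * (f * words f (suc n) (suc x))
      ≡⟨ alg₂ n f (words f n (suc x)) (words f (suc n) (suc x)) (suc x) ⟩
    f * (suc n * words f n (suc x) + suc x * words f (suc n) (suc x)) + f * words f (suc n) (suc x)
      ≡⟨ cong (λ z → f * (suc n * words f n (suc x) + z) + f * words f (suc n) (suc x))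
              (words-absorption f n x) ⟩
    f * (suc n * words f n (suc x) + suc n * (f * words f n x)) + f * words f (suc n) (suc x)
      ≡⟨ alg₃ n f (words f n (suc x)) (words f n x) ⟩
    suc (suc n) * (f * words f (suc n) (suc x)) ∎

factor : ∀ p f a b → p * a + f * (p * b) ≡ p * (a + f * b)
factor = solve-∀

-- Counting vectors with a prescribed number of nonempty entries

module Selections {Code : Set} (∅ : Code) (F : List Code) where

  -- The vectors with x entries from F and the other entries ∅.
  selections : ∀ n → ℕ → List (Vec Code n)
  selections zero    zero    = [ [] ]
  selections zero    (suc x) = []
  selections (suc n) x =
    map (∅ ∷_) (selections n x) ++ cartesianProductWith _∷_ F (shift [] (selections n) x)

  f : ℕ
  f = count (const true) F

  count-shift : ∀ n (φ : Vec Code n → Bool) (g : ℕ → ℕ) → (∀ x → count φ (selections n x) ≡ g x) →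
    ∀ x → count φ (shift [] (selections n) x) ≡ shift 0 g x
  count-shift n φ g eq zero    = refl
  count-shift n φ g eq (suc x) = eq x

  -- A selection starts with `∅` or with an entry of `F`; in the second case the predicate factors,
  -- so the count is a product. The `shift` records that with `x = 0` the second case cannot occur.
  count-selections : ∀ n (φ : Vec Code (suc n) → Bool) (χ : Code → Bool) (ψ : Vec Code n → Bool) →
    (∀ c cs → φ (c ∷ cs) ≡ χ c ∧ ψ cs) → ∀ x →
    count φ (selections (suc n) x) ≡
    count (φ ∘ (∅ ∷_)) (selections n x) + count χ F * count ψ (shift [] (selections n) x)
  count-selections n φ χ ψ eq x = trans (count-++ φ (map (∅ ∷_) (selections n x)) _)
    (cong₂ _+_ (count-map φ (∅ ∷_) (selections n x))
               (count-cartesianProductWith φ χ ψ _∷_ eq F _))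

  count-all : ∀ n x → count (const true) (selections n x) ≡ words f n x
  count-all zero    zero    = refl
  count-all zero    (suc x) = refl
  count-all (suc n) x = trans
    (count-selections n (const true) (const true) (const true) (λ _ _ → refl) x)
    (cong₂ _+_ (count-all n x) (cong (f *_) (count-shift n (const true) (words f n) (count-all n) x)))

  module _ (φ : Code → Bool) (φ∅ : φ ∅ ≡ false) where

    -- Since `φ` rejects `∅`, position `i` holds one of the entries of `F` that satisfy `φ`, and the
    -- other `n` positions carry `x - 1` entries freely.
    count-one : ∀ {n} (i : Fin (suc n)) x →
      count (λ cs → φ (lookup cs i)) (selections (suc n) x) ≡ count φ F * shift 0 (words f n) x
    count-one {n} zero x = trans
      (count-selections n (λ cs → φ (lookup cs zero)) φ (const true)
        (λ c _ → sym (∧-identityʳ (φ c))) x)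
      (cong₂ _+_ (trans (count-cong (λ _ → φ∅) (selections n x)) (count-none (selections n x)))
                 (cong (count φ F *_) (count-shift n _ _ (count-all n) x)))
    count-one {suc n} (suc i) x = begin
      count (λ cs → φ (lookup cs (suc i))) (selections (suc (suc n)) x)
        ≡⟨ count-selections (suc n) _ (const true) (λ cs → φ (lookup cs i)) (λ _ _ → refl) x ⟩
      count (λ cs → φ (lookup cs i)) (selections (suc n) x) +
      f * count (λ cs → φ (lookup cs i)) (shift [] (selections (suc n)) x)
        ≡⟨ cong₂ _+_ (count-one i x) (cong (f *_) (count-shift (suc n) _ _ (count-one i) x)) ⟩
      p * shift 0 (words f n) x + f * shift 0 (λ x → p * shift 0 (words f n) x) x
        ≡⟨ alg x ⟩
      p * shift 0 (words f (suc n)) x ∎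
      where
      open ≡-Reasoning
      p = count φ F
      alg : ∀ x → p * shift 0 (words f n) x + f * shift 0 (λ x → p * shift 0 (words f n) x) x ≡
                  p * shift 0 (words f (suc n)) x
      alg zero    rewrite *-zeroʳ f = +-identityʳ _
      alg (suc x) = factor p f (words f n x) (shift 0 (words f n) x)

  module _ (φ ψ : Code → Bool) (φ∅ : φ ∅ ≡ false) (ψ∅ : ψ ∅ ≡ false) where
    open ≡-Reasoning

    private
      p = count φ F
      q = count ψ F

    -- Two distinct positions are filled independently, which leaves `x - 2` entries for the
    -- remaining `n` positions.
    count-two : ∀ {n} (i j : Fin (suc (suc n))) → i ≢ j → ∀ x →
      count (λ cs → φ (lookup cs i) ∧ ψ (lookup cs j)) (selections (suc (suc n)) x) ≡
      p * q * shift 0 (shift 0 (words f n)) x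
    count-two zero zero i≢j x = contradiction refl i≢j
    count-two {n} zero (suc j) i≢j x = begin
      count (λ cs → φ (lookup cs zero) ∧ ψ (lookup cs (suc j))) (selections (suc (suc n)) x)
        ≡⟨ count-selections (suc n) _ φ (λ cs → ψ (lookup cs j)) (λ _ _ → refl) x ⟩
      count (λ cs → φ ∅ ∧ ψ (lookup cs j)) (selections (suc n) x) +
      p * count (λ cs → ψ (lookup cs j)) (shift [] (selections (suc n)) x)
        ≡⟨ cong₂ _+_
             (trans (count-cong (λ cs → cong (_∧ ψ (lookup cs j)) φ∅) (selections (suc n) x))
                    (count-none (selections (suc n) x)))
             (cong (p *_) (count-shift (suc n) _ _ (count-one ψ ψ∅ j) x)) ⟩
      p * shift 0 (λ x → q * shift 0 (words f n) x) x
        ≡⟨ alg x ⟩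
      p * q * shift 0 (shift 0 (words f n)) x ∎
      where
      alg : ∀ x → p * shift 0 (λ x → q * shift 0 (words f n) x) x ≡
                  p * q * shift 0 (shift 0 (words f n)) x
      alg zero    = trans (*-zeroʳ p) (sym (*-zeroʳ (p * q)))
      alg (suc x) = sym (*-assoc p q _)
    count-two {n} (suc i) zero i≢j x = begin
      count (λ cs → φ (lookup cs (suc i)) ∧ ψ (lookup cs zero)) (selections (suc (suc n)) x)
        ≡⟨ count-selections (suc n) _ ψ (λ cs → φ (lookup cs i))
             (λ c cs → ∧-comm (φ (lookup cs i)) (ψ c)) x ⟩
      count (λ cs → φ (lookup cs i) ∧ ψ ∅) (selections (suc n) x) +
      q * count (λ cs → φ (lookup cs i)) (shift [] (selections (suc n)) x)
        ≡⟨ cong₂ _+_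
             (trans (count-cong (λ cs → trans (cong (φ (lookup cs i) ∧_) ψ∅) (∧-comm _ false))
                                (selections (suc n) x))
                    (count-none (selections (suc n) x)))
             (cong (q *_) (count-shift (suc n) _ _ (count-one φ φ∅ i) x)) ⟩
      q * shift 0 (λ x → p * shift 0 (words f n) x) x
        ≡⟨ alg x ⟩
      p * q * shift 0 (shift 0 (words f n)) x ∎
      where
      alg : ∀ x → q * shift 0 (λ x → p * shift 0 (words f n) x) x ≡
                  p * q * shift 0 (shift 0 (words f n)) x
      alg zero    = trans (*-zeroʳ q) (sym (*-zeroʳ (p * q)))
      alg (suc x) = trans (sym (*-assoc q p _)) (cong (_* shift 0 (words f n) x) (*-comm q p))
    count-two {zero}  (suc zero) (suc zero) i≢j x = contradiction refl i≢j
    count-two {suc n} (suc i) (suc j) i≢j x = begin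
      count (λ cs → φ (lookup cs (suc i)) ∧ ψ (lookup cs (suc j))) (selections (3 + n) x)
        ≡⟨ count-selections (2 + n) _ (const true) (λ cs → φ (lookup cs i) ∧ ψ (lookup cs j))
             (λ _ _ → refl) x ⟩
      count (λ cs → φ (lookup cs i) ∧ ψ (lookup cs j)) (selections (2 + n) x) +
      f * count (λ cs → φ (lookup cs i) ∧ ψ (lookup cs j)) (shift [] (selections (2 + n)) x)
        ≡⟨ cong₂ _+_ (ih x) (cong (f *_) (count-shift (2 + n) _ _ ih x)) ⟩
      p * q * shift 0 (shift 0 (words f n)) x +
      f * shift 0 (λ x → p * q * shift 0 (shift 0 (words f n)) x) x
        ≡⟨ alg x ⟩
      p * q * shift 0 (shift 0 (words f (suc n))) x ∎
      where
      ih = count-two i j (i≢j ∘ cong suc)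
      alg : ∀ x → p * q * shift 0 (shift 0 (words f n)) x +
                  f * shift 0 (λ x → p * q * shift 0 (shift 0 (words f n)) x) x ≡
                  p * q * shift 0 (shift 0 (words f (suc n))) x
      alg zero          rewrite *-zeroʳ f = +-identityʳ _
      alg (suc zero)    rewrite *-zeroʳ (p * q) | *-zeroʳ f = refl
      alg (suc (suc x)) = factor (p * q) f (words f n x) (shift 0 (words f n) x)

-- Membership in `selections` and rearrangement by permutations

indicator : Bool → ℕ
indicator b = if b then 1 else 0

sum-below : ∀ {n x} → x ≤ n → sum {n} (λ i → indicator (toℕ i <ᵇ x)) ≡ x
sum-below {zero}  z≤n       = refl
sum-below {suc n} z≤n       = sum-below {n} z≤n
sum-below {suc n} (s≤s x≤n) = cong suc (sum-below x≤n)

-- Deleting the position with value exactly `x` fixes the smaller positions and lowers the larger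
-- ones to at least `x`, so being below `x` does not change. The converse is `<-punchOut`.
punchOut-< : ∀ {n x} {i j : Fin (suc n)} (i≢j : i ≢ j) → toℕ i ≡ x →
  toℕ (punchOut i≢j) < x → toℕ j < x
punchOut-< {suc n} {i = suc i} {zero}  i≢j refl p       = s≤s z≤n
punchOut-< {suc n} {i = suc i} {suc j} i≢j refl (s≤s p) = s≤s (punchOut-< (i≢j ∘ cong suc) refl p)

<-punchOut : ∀ {n x} {i j : Fin (suc n)} (i≢j : i ≢ j) → toℕ i ≡ x →
  toℕ j < x → toℕ (punchOut i≢j) < x
<-punchOut {suc n} {i = suc i} {zero}  i≢j refl p       = s≤s z≤n
<-punchOut {suc n} {i = suc i} {suc j} i≢j refl (s≤s p) = s≤s (<-punchOut (i≢j ∘ cong suc) refl p)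

module SelectionMembership {Code : Set} (∅ : Code) (F : List Code)
  (F-unique : Unique F) (∅∉F : ∅ ∉ F) where
  open Selections ∅ F

  selections-unique : ∀ n x → Unique (selections n x)
  shift-unique : ∀ n x → Unique (shift [] (selections n) x)
  selections-unique zero    zero    = [] ∷ []
  selections-unique zero    (suc x) = []
  selections-unique (suc n) x = ++⁺ (map⁺ ∷-injectiveʳ (selections-unique n x))
    (cartesianProductWith⁺ _∷_ (λ {refl → refl , refl}) F-unique (shift-unique n x))
    λ (p , q) → disjoint p q
    where
    disjoint : ∀ {cs} → cs ∈ map (∅ ∷_) (selections n x) →
      cs ∉ cartesianProductWith _∷_ F (shift [] (selections n) x)
    disjoint p q with ∈-map⁻ (∅ ∷_) p | ∈-cartesianProductWith⁻ _∷_ F _ q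
    ... | _ , _ , refl | _ , _ , ∅∈F , _ , refl = ∅∉F ∅∈F
  shift-unique n zero    = []
  shift-unique n (suc x) = selections-unique n x

  -- The number of nonempty entries is kept as a sum of indicators: it computes along the recursion,
  -- and its invariance under permutations later identifies it with `x`.
  tabulate-∈-selections : ∀ {n} (b : Fin n → Bool) (t : Fin n → Code) →
    (∀ j → b j ≡ true → t j ∈ F) → (∀ j → b j ≡ false → t j ≡ ∅) →
    tabulate t ∈ selections n (sum (indicator ∘ b))
  tabulate-∈-selections {zero}  b t in-F is-∅ = here refl
  tabulate-∈-selections {suc n} b t in-F is-∅
    with b zero in b₀ | tabulate-∈-selections (b ∘ suc) (t ∘ suc) (in-F ∘ suc) (is-∅ ∘ suc)
  ... | true  | rec = ∈-++⁺ʳ _ (∈-cartesianProductWith⁺ _∷_ (in-F zero b₀) rec)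
  ... | false | rec rewrite is-∅ zero b₀ = ∈-++⁺ˡ (∈-map⁺ (∅ ∷_) rec)

  -- ρ sends the positions below x to the entries from F, as an element of G sends the classes
  -- that meet B to those that meet its image.
  record Arrangement {n} (x : ℕ) (cs : Vec Code n) : Set where
    field
      x≤n : x ≤ n
      ρ   : Permutation′ n
      in-F : ∀ i → toℕ i < x → lookup cs (ρ ⟨$⟩ʳ i) ∈ F
      is-∅ : ∀ i → x ≤ toℕ i → lookup cs (ρ ⟨$⟩ʳ i) ≡ ∅

  -- A leading `∅` becomes the image of position `x`, the first that has to be empty, by insertion
  -- into the permutation of the tail. A leading entry of `F` becomes the image of position zero, so
  -- lifting suffices and `x` grows by one.
  arrangement : ∀ {n x} {cs : Vec Code n} → cs ∈ selections n x → Arrangement x cs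
  arrangement {zero}  {zero} (here refl) = record
    { x≤n = z≤n ; ρ = Perm.id ; in-F = λ () ; is-∅ = λ () }
  arrangement {suc n} {x} cs∈ with ∈-++⁻ (map (∅ ∷_) (selections n x)) cs∈
  ... | inj₁ p with ∈-map⁻ (∅ ∷_) p
  ...   | cs , cs∈ , refl = extended
    where
    open Arrangement (arrangement cs∈)
    x̂ : Fin (suc n)
    x̂ = fromℕ< (s≤s x≤n)
    toℕ-x̂ : toℕ x̂ ≡ x
    toℕ-x̂ = Fin.toℕ-fromℕ< (s≤s x≤n)
    in-F′ : ∀ i → toℕ i < x → lookup (∅ ∷ cs) (insert x̂ zero ρ ⟨$⟩ʳ i) ∈ F
    in-F′ i i<x with x̂ Fin.≟ i
    ... | yes refl = contradiction (sym toℕ-x̂) (>⇒≢ i<x)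
    ... | no  x̂≢i = in-F _ (<-punchOut x̂≢i toℕ-x̂ i<x)
    is-∅′ : ∀ i → x ≤ toℕ i → lookup (∅ ∷ cs) (insert x̂ zero ρ ⟨$⟩ʳ i) ≡ ∅
    is-∅′ i x≤i with x̂ Fin.≟ i
    ... | yes _    = refl
    ... | no  x̂≢i = is-∅ _ (≮⇒≥ λ p → <⇒≱ (punchOut-< x̂≢i toℕ-x̂ p) x≤i)
    extended : Arrangement x (∅ ∷ cs)
    extended = record { x≤n = m≤n⇒m≤1+n x≤n ; ρ = insert x̂ zero ρ ; in-F = in-F′ ; is-∅ = is-∅′ }
  arrangement {suc n} {zero}  cs∈ | inj₂ p with ∈-cartesianProductWith⁻ _∷_ F [] p
  ... | _ , _ , _ , () , _
  arrangement {suc n} {suc x} cs∈ | inj₂ p with ∈-cartesianProductWith⁻ _∷_ F (selections n x) p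
  ... | c , cs , c∈F , cs∈ , refl = record
    { x≤n = s≤s x≤n ; ρ = lift₀ ρ
    ; in-F = λ { zero _ → c∈F ; (suc i) (s≤s i<x) → in-F i i<x }
    ; is-∅ = λ { (suc i) (s≤s x≤i) → is-∅ i x≤i } }
    where open Arrangement (arrangement cs∈)

-- Families of subsets and the wreath construction

-- A class of subsets of Q together with a duplicate-free list of all of them, up to ≐; the code ∅
-- of the empty set serves to describe subsets of Q × Fin n fibre by fibre.
record Family (Q : Set) : Set₁ where
  field
    Block    : Pred (Pred Q 0ℓ) 0ℓ
    Code     : Set
    _∋_      : Code → Q → Bool
    ext      : ∀ {c c′} → (∀ q → c ∋ q ≡ c′ ∋ q) → c ≡ c′
    ∅        : Code
    ∅-empty  : ∀ q → ∅ ∋ q ≡ false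
    codes    : List Code
    unique   : Unique codes
    ∅∉codes  : ∅ ∉ codes
    encode   : ∀ {X} → Block X → ∃[ c ] c ∈ codes × ∀ q → X q ⇔ T (c ∋ q)
    decode   : ∀ {c} → c ∈ codes → Block (λ q → T (c ∋ q))

-- Base of the tower: with the one-point set as only block, the first wreath step yields the subsets
-- of `Fin n` of a fixed size.
singleton : Family ⊤
singleton = record
  { Block   = λ X → X tt
  ; Code    = Bool
  ; _∋_     = λ c _ → c
  ; ext     = λ eq → eq tt
  ; ∅       = false
  ; ∅-empty = λ _ → refl
  ; codes   = [ true ]
  ; unique  = [] ∷ []
  ; ∅∉codes = λ { (here ()) ; (there ()) }
  ; encode  = λ p → true , here refl , λ _ → mk⇔ (const tt) (const p)
  ; decode  = λ { (here refl) → tt }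
  }

module Wreath {Q : Set} (𝓕 : Family Q) (n x : ℕ) (0<x : 0 < x) (x≤n : x ≤ n) where
  open Family 𝓕
  open Selections ∅ codes
  open SelectionMembership ∅ codes unique ∅∉codes

  -- The fibres that are met are described by a permutation instead of a count, to match the top
  -- component of an element of `G`; the lower components are hidden in `Block`.
  WreathBlock : Pred (Pred (Q × Fin n) 0ℓ) 0ℓ
  WreathBlock X = Σ[ ρ ∈ Permutation′ n ] ∀ i →
    (toℕ i < x → Block (λ q → X (q , ρ ⟨$⟩ʳ i))) × (x ≤ toℕ i → ∀ q → ¬ X (q , ρ ⟨$⟩ʳ i))

  private
    cell : ∀ {Y : Pred Q 0ℓ} i → (i < x → Block Y) → (x ≤ i → ∀ q → ¬ Y q) →
      ∃[ c ] ((i <ᵇ x) ≡ true → c ∈ codes) × ((i <ᵇ x) ≡ false → c ≡ ∅) × (∀ q → Y q ⇔ T (c ∋ q))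
    cell i blk emp with i <ᵇ x in eq
    ... | true  = let c , c∈ , spec = encode (blk (<ᵇ⇒< i x (subst T (sym eq) tt)))
                  in c , const c∈ , (λ ()) , spec
    ... | false = ∅ , (λ ()) , const refl , λ q →
      mk⇔ (λ y → contradiction y (emp (≮⇒≥ λ i<x → subst T eq (<⇒<ᵇ i<x)) q))
          (λ t → contradiction (subst T (∅-empty q) t) λ ())

    wreath-encode : ∀ {X} → WreathBlock X →
      ∃[ cs ] cs ∈ selections n x × ∀ qi → X qi ⇔ T (lookup cs (proj₂ qi) ∋ proj₁ qi)
    wreath-encode {X} (ρ , blk) =
      tabulate t , subst (λ z → tabulate t ∈ selections n z) count-b t∈ , spec
      where
      position : Fin n → Fin n
      position j = ρ ⟨$⟩ˡ j
      the-cell : ∀ j → _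
      the-cell j = cell {λ q → X (q , ρ ⟨$⟩ʳ position j)} (toℕ (position j))
        (proj₁ (blk (position j))) (proj₂ (blk (position j)))
      t : Fin n → Code
      t j = proj₁ (the-cell j)
      b : Fin n → Bool
      b j = toℕ (position j) <ᵇ x
      t∈ : tabulate t ∈ selections n (sum (indicator ∘ b))
      t∈ = tabulate-∈-selections b t
        (λ j → proj₁ (proj₂ (the-cell j))) (λ j → proj₁ (proj₂ (proj₂ (the-cell j))))
      count-b : sum (indicator ∘ b) ≡ x
      -- `b` is the indicator of the first `x` positions transported along the inverse of `ρ`, so
      -- its sum is still `x`.
      count-b = trans
        (sym (sum-permute (λ i → indicator (toℕ i <ᵇ x)) (Perm.flip ρ))) (sum-below x≤n)
      spec : ∀ qi → X qi ⇔ T (lookup (tabulate t) (proj₂ qi) ∋ proj₁ qi)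
      spec (q , j) rewrite lookup∘tabulate t j =
        subst (λ j′ → X (q , j′) ⇔ T (t j ∋ q)) (inverseʳ ρ) (proj₂ (proj₂ (proj₂ (the-cell j))) q)

    wreath-decode : ∀ {cs} → cs ∈ selections n x →
      WreathBlock (λ qi → T (lookup cs (proj₂ qi) ∋ proj₁ qi))
    wreath-decode {cs} cs∈ = ρ , λ i → decode ∘ in-F i ,
      λ x≤i q t → subst T (trans (cong (_∋ q) (is-∅ i x≤i)) (∅-empty q)) t
      where open Arrangement (arrangement cs∈)

    lookup-ext : ∀ (cs cs′ : Vec Code n) → (∀ i → lookup cs i ≡ lookup cs′ i) → cs ≡ cs′
    lookup-ext cs cs′ eq =
      trans (sym (tabulate∘lookup cs)) (trans (tabulate-cong eq) (tabulate∘lookup cs′))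

  wreath : Family (Q × Fin n)
  wreath = record
    { Block   = WreathBlock
    ; Code    = Vec Code n
    ; _∋_     = λ cs (q , i) → lookup cs i ∋ q
    ; ext     = λ {cs} {cs′} eq → lookup-ext cs cs′ λ i → ext λ q → eq (q , i)
    ; ∅       = replicate n ∅
    ; ∅-empty = λ (q , i) → trans (cong (_∋ q) (lookup-replicate i ∅)) (∅-empty q)
    ; codes   = selections n x
    ; unique  = selections-unique n x
    -- Position zero lies below `x`, so an empty selection would put `∅` among the codes one level
    -- down.
    ; ∅∉codes = λ ∅∈ → let open Arrangement (arrangement ∅∈) using (ρ; in-F)
                           i = fromℕ< (<-≤-trans 0<x x≤n)
                       in ∅∉codes (subst (_∈ codes) (lookup-replicate (ρ ⟨$⟩ʳ i) ∅)
                            (in-F i (subst (_< x) (sym (Fin.toℕ-fromℕ< (<-≤-trans 0<x x≤n))) 0<x)))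
    ; encode  = wreath-encode
    ; decode  = wreath-decode
    }

-- Point and pair counts under the wreath construction

-- There are u + 1 points and the blocks have size κ + 1; in design notation flags and pairs are
-- b k = r v and r (k - 1) = λ (v - 1).
record Balanced {Q : Set} (𝓕 : Family Q) (κ u : ℕ) : Set where
  open Family 𝓕
  size : ℕ
  size = count (const true) codes
  field
    r l   : ℕ
    point-count : ∀ q → count (_∋ q) codes ≡ r
    pair-count  : ∀ p q → p ≢ q → count (λ c → c ∋ p ∧ c ∋ q) codes ≡ l
    flags : size * suc κ ≡ r * suc u
    pairs : r * κ ≡ l * u
    nontrivial : ∀ (p q : Q) → p ≢ q → NonZero u

-- There are no two distinct points and `u = 0`, so any `l` is admissible; zero is taken.
singleton-balanced : Balanced singleton 0 0
singleton-balanced = record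
  { r = 1 ; l = 0 ; point-count = λ _ → refl ; pair-count = λ p q p≢q → contradiction refl p≢q
  ; flags = refl ; pairs = refl ; nontrivial = λ p q p≢q → contradiction refl p≢q }

-- The proportion (k - 1) (n - 1) v = (x - 1) k (v - 1) says that two points in the same fibre
-- lie in as many blocks as two points in different fibres; n and x are shifted by 2.
module WreathBalanced {Q : Set} {𝓕 : Family Q} {κ u} (bal : Balanced 𝓕 κ u) (n x : ℕ)
  (x≤n : 2 + x ≤ 2 + n) (proportion : κ * suc n * suc u ≡ suc x * suc κ * u) where

  open Family 𝓕
  open Balanced bal
  open Selections ∅ codes using (f; selections; count-all)
  open Wreath 𝓕 (2 + n) (2 + x) (s≤s z≤n) x≤n
  open ≡-Reasoning

  private
    -- The number of ways to fill the remaining fibres once two fibres (`N₀`) or one fibre (`N₁`)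
    -- have been filled.
    N₀ N₁ : ℕ
    N₀ = words f n x
    N₁ = words f (1 + n) (1 + x)

    absorb : suc x * N₁ ≡ suc n * (f * N₀)
    absorb = words-absorption f n x

    point-count′ : ∀ qi →
      count (λ cs → lookup cs (proj₂ qi) ∋ proj₁ qi) (selections (2 + n) (2 + x)) ≡ r * N₁
    point-count′ (q , i) = trans
      (Selections.count-one ∅ codes (_∋ q) (∅-empty q) i (2 + x)) (cong (_* N₁) (point-count q))

    -- This is `same` with `N₀` and `N₁` eliminated through `absorb`. After multiplication by
    -- `u * suc κ`, which can be cancelled as `u` is nonzero, `pairs` and `flags` turn it into
    -- `proportion`.
    coefficient : .{{NonZero u}} → l * suc n * f ≡ suc x * (r * r)
    coefficient = *-cancelʳ-≡ _ _ (u * suc κ) {{m*n≢0 u (suc κ)}} (begin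
      l * suc n * f * (u * suc κ)        ≡⟨ alg₁ l n f u κ ⟩
      (l * u) * suc n * (f * suc κ)      ≡⟨ cong₂ (λ y z → y * suc n * z) (sym pairs) flags ⟩
      (r * κ) * suc n * (r * suc u)      ≡⟨ alg₂ r κ n u ⟩
      r * r * (κ * suc n * suc u)        ≡⟨ cong (r * r *_) proportion ⟩
      r * r * (suc x * suc κ * u)        ≡⟨ alg₃ r x κ u ⟩
      suc x * (r * r) * (u * suc κ)      ∎)
      where
      alg₁ : ∀ l n f u κ → l * suc n * f * (u * suc κ) ≡ (l * u) * suc n * (f * suc κ)
      alg₁ = solve-∀
      alg₂ : ∀ r κ n u → (r * κ) * suc n * (r * suc u) ≡ r * r * (κ * suc n * suc u)
      alg₂ = solve-∀
      alg₃ : ∀ r x κ u → r * r * (suc x * suc κ * u) ≡ suc x * (r * r) * (u * suc κ)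
      alg₃ = solve-∀

    -- The left side counts blocks through two points of one fibre, the right side blocks through
    -- points of two different fibres.
    same : .{{NonZero u}} → l * N₁ ≡ r * r * N₀
    same = *-cancelˡ-≡ _ _ (suc x) (begin
      suc x * (l * N₁)           ≡⟨ alg₁ x l N₁ ⟩
      l * (suc x * N₁)           ≡⟨ cong (l *_) absorb ⟩
      l * (suc n * (f * N₀))     ≡⟨ alg₂ l n f N₀ ⟩
      (l * suc n * f) * N₀       ≡⟨ cong (_* N₀) coefficient ⟩
      (suc x * (r * r)) * N₀     ≡⟨ *-assoc (suc x) (r * r) N₀ ⟩
      suc x * (r * r * N₀)       ∎)
      where
      alg₁ : ∀ x l m → suc x * (l * m) ≡ l * (suc x * m)
      alg₁ = solve-∀
      alg₂ : ∀ l n f m → l * (suc n * (f * m)) ≡ l * suc n * f * m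
      alg₂ = solve-∀

    pair-count′ : ∀ p q → p ≢ q →
      count (λ cs → (lookup cs (proj₂ p) ∋ proj₁ p) ∧ (lookup cs (proj₂ q) ∋ proj₁ q))
            (selections (2 + n) (2 + x)) ≡ r * r * N₀
    pair-count′ (p , i) (q , j) p≢q with i Fin.≟ j
    ... | no  i≢j = trans
      (Selections.count-two ∅ codes (_∋ p) (_∋ q) (∅-empty p) (∅-empty q) i j i≢j (2 + x))
      (cong (_* N₀) (cong₂ _*_ (point-count p) (point-count q)))
    ... | yes refl = trans
      (Selections.count-one ∅ codes (λ c → (c ∋ p) ∧ (c ∋ q)) (cong (_∧ (∅ ∋ q)) (∅-empty p)) i (2 + x))
      (trans (cong (_* N₁) (pair-count p q p≢q′)) (same {{nontrivial p q p≢q′}}))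
      where
      p≢q′ : p ≢ q
      p≢q′ = p≢q ∘ cong (_, i)

    -- Chosen so that κ′ + 1 = (κ + 1)(x + 2) and u′ + 1 = (u + 1)(n + 2).
    κ′ u′ : ℕ
    κ′ = κ + suc κ * suc x
    u′ = u + suc u * suc n

    flags′ : count (const true) (selections (2 + n) (2 + x)) * suc κ′ ≡ r * N₁ * suc u′
    flags′ = begin
      count (const true) (selections (2 + n) (2 + x)) * suc κ′
        ≡⟨ cong (_* suc κ′) (count-all (2 + n) (2 + x)) ⟩
      words f (2 + n) (2 + x) * suc κ′             ≡⟨ alg₁ (words f (2 + n) (2 + x)) κ x ⟩
      ((2 + x) * words f (2 + n) (2 + x)) * suc κ
        ≡⟨ cong (_* suc κ) (words-absorption f (1 + n) (1 + x)) ⟩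
      ((2 + n) * (f * N₁)) * suc κ             ≡⟨ alg₂ n f N₁ κ ⟩
      (f * suc κ) * (N₁ * (2 + n))             ≡⟨ cong (_* (N₁ * (2 + n))) flags ⟩
      (r * suc u) * (N₁ * (2 + n))             ≡⟨ alg₃ r u N₁ n ⟩
      r * N₁ * suc u′                          ∎
      where
      alg₁ : ∀ m κ x → m * suc (κ + suc κ * suc x) ≡ ((2 + x) * m) * suc κ
      alg₁ = solve-∀
      alg₂ : ∀ n f m κ → ((2 + n) * (f * m)) * suc κ ≡ (f * suc κ) * (m * (2 + n))
      alg₂ = solve-∀
      alg₃ : ∀ r u m n → (r * suc u) * (m * (2 + n)) ≡ r * m * suc (u + suc u * suc n)
      alg₃ = solve-∀

    pairs′ : r * N₁ * κ′ ≡ r * r * N₀ * u′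
    pairs′ = *-cancelʳ-≡ _ _ (suc x * suc κ) (begin
      r * N₁ * κ′ * (suc x * suc κ)                  ≡⟨ alg₁ r N₁ κ′ x κ ⟩
      r * κ′ * suc κ * (suc x * N₁)                  ≡⟨ cong (r * κ′ * suc κ *_) absorb ⟩
      r * κ′ * suc κ * (suc n * (f * N₀))            ≡⟨ alg₂ r κ′ κ n f N₀ ⟩
      r * κ′ * suc n * N₀ * (f * suc κ)              ≡⟨ cong (r * κ′ * suc n * N₀ *_) flags ⟩
      r * κ′ * suc n * N₀ * (r * suc u)              ≡⟨ alg₃ r κ x n N₀ u ⟩
      r * r * N₀ * (κ * suc n * suc u + suc κ * suc x * suc n * suc u)
        ≡⟨ cong (λ z → r * r * N₀ * (z + suc κ * suc x * suc n * suc u)) proportion ⟩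
      r * r * N₀ * (suc x * suc κ * u + suc κ * suc x * suc n * suc u)
        ≡⟨ alg₄ r N₀ x κ u n ⟩
      r * r * N₀ * u′ * (suc x * suc κ)              ∎)
      where
      alg₁ : ∀ r m k x κ → r * m * k * (suc x * suc κ) ≡ r * k * suc κ * (suc x * m)
      alg₁ = solve-∀
      alg₂ : ∀ r k κ n f m → r * k * suc κ * (suc n * (f * m)) ≡ r * k * suc n * m * (f * suc κ)
      alg₂ = solve-∀
      alg₃ : ∀ r κ x n m u → r * (κ + suc κ * suc x) * suc n * m * (r * suc u) ≡
        r * r * m * (κ * suc n * suc u + suc κ * suc x * suc n * suc u)
      alg₃ = solve-∀
      alg₄ : ∀ r m x κ u n → r * r * m * (suc x * suc κ * u + suc κ * suc x * suc n * suc u) ≡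
        r * r * m * (u + suc u * suc n) * (suc x * suc κ)
      alg₄ = solve-∀

  wreath-balanced : Balanced wreath (κ + suc κ * suc x) (u + suc u * suc n)
  wreath-balanced = record
    { r = r * N₁ ; l = r * r * N₀ ; point-count = point-count′ ; pair-count = pair-count′
    ; flags = flags′ ; pairs = pairs′
    ; nontrivial = λ _ _ _ → ≢-nonZero λ eq → 1+n≢0 {n + u * suc n} (m+n≡0⇒n≡0 u eq) }

-- From code counts to cardinalities of sets of blocks

index-∈-lookup : ∀ {A : Set} (xs : List A) i → index (∈-lookup {xs = xs} i) ≡ i
index-∈-lookup (x ∷ xs) zero    = refl
index-∈-lookup (x ∷ xs) (suc i) = cong suc (index-∈-lookup xs i)

-- In a duplicate-free list each element has at most one membership proof, so its position depends
-- on the element alone.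
index-cong : ∀ {A : Set} {xs : List A} → Unique xs → ∀ {x y} (p : x ∈ xs) (q : y ∈ xs) →
  x ≡ y → index p ≡ index q
index-cong xs! p q refl = cong index (unique⇒irrelevant xs! p q)

module _ {P Q : Set} (η : P → Q) (η-surjective : ∀ q → ∃[ p ] η p ≡ q) (𝓕 : Family Q) where
  open Family 𝓕

  -- The count is by definition the length of the filtered list of codes, so a block is sent to the
  -- position of its code there. The map `η` bridges two presentations of the point set.
  blocks-through : ∀ {𝓑 : Pred (Pred P 0ℓ) 0ℓ} →
    (∀ {X} → 𝓑 X → ∃[ c ] c ∈ codes × ∀ p → X p ⇔ T (c ∋ η p)) →
    (∀ {c} → c ∈ codes → 𝓑 (λ p → T (c ∋ η p))) →
    ∀ p q → HasCardinality (≐-setoid P 0ℓ) (λ X → 𝓑 X × X p × X q)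
              (count (λ c → (c ∋ η p) ∧ (c ∋ η q)) codes)
  blocks-through {𝓑} enc dec p q = record
    { to = to
    ; from = from
    ; to-cong = λ {X} {Y} → to-cong {X} {Y}
    ; from-cong = λ { refl → (λ z → z) , (λ z → z) }
    ; inverse = (λ {i} {X} → inverseˡ′ {i} {X}) , (λ {X} {i} → inverseʳ′ {X} {i})
    }
    where
    φ : Code → Bool
    φ c = (c ∋ η p) ∧ (c ∋ η q)
    L : List Code
    L = filterᵇ φ codes
    L-unique : Unique L
    L-unique = filter⁺ (T? ∘ φ) unique
    Blocks : Set₁
    Blocks = Σ (Pred P 0ℓ) (λ X → 𝓑 X × X p × X q)

    code : ((X , _) : Blocks) → ∃[ c ] c ∈ L × ∀ p → X p ⇔ T (c ∋ η p)
    code (X , b , p∈ , q∈) =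
      let c , c∈ , spec = enc b
      in c , ∈-filter⁺ (T? ∘ φ) c∈ (⇐ T-∧ (⇒ (spec p) p∈ , ⇒ (spec q) q∈)) , spec

    to : Blocks → Fin (length L)
    to X = index (proj₁ (proj₂ (code X)))

    from : Fin (length L) → Blocks
    from i =
      let c∈ , pq = ∈-filter⁻ (T? ∘ φ) {xs = codes} (∈-lookup {xs = L} i)
          t = ⇒ T-∧ pq
      in (λ p → T (List.lookup L i ∋ η p)) , dec c∈ , proj₁ t , proj₂ t

    -- Extensionality of codes asks for agreement at every point of `Q`; surjectivity of `η` reaches
    -- them all.
    same-code : ∀ {c c′} → (∀ p → T (c ∋ η p) ⇔ T (c′ ∋ η p)) → c ≡ c′
    same-code eq = ext λ q → let p , ηp≡q = η-surjective q in
      subst (λ q → _ ∋ q ≡ _ ∋ q) ηp≡q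
        (⇔→≡ (mk⇔ (⇒ T-≡ ∘ ⇒ (eq p) ∘ ⇐ T-≡) (⇒ T-≡ ∘ ⇐ (eq p) ∘ ⇐ T-≡)))

    to-cong : ∀ {X Y : Blocks} → proj₁ X ≐ proj₁ Y → to X ≡ to Y
    to-cong {X} {Y} (X⊆Y , Y⊆X) =
      let _ , c∈  , spec  = code X
          _ , c′∈ , spec′ = code Y
      in index-cong L-unique c∈ c′∈ (same-code λ p →
           mk⇔ (⇒ (spec′ p) ∘ X⊆Y ∘ ⇐ (spec p)) (⇒ (spec p) ∘ Y⊆X ∘ ⇐ (spec′ p)))

    to∘from : ∀ i → to (from i) ≡ i
    to∘from i =
      let _ , c∈ , spec = code (from i)
      in trans (index-cong L-unique c∈ (∈-lookup {xs = L} i)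
                                    (same-code λ p → mk⇔ (⇐ (spec p)) (⇒ (spec p))))
               (index-∈-lookup L i)

    inverseˡ′ : ∀ {i X} → proj₁ X ≐ proj₁ (from i) → to X ≡ i
    inverseˡ′ {i} {X} eq = trans (to-cong {X} {from i} eq) (to∘from i)

    inverseʳ′ : ∀ {X i} → i ≡ to X → proj₁ (from i) ≐ proj₁ X
    inverseʳ′ {X} refl =
      let c , c∈ , spec = code X
      in (λ {p} t → ⇐ (spec p) (subst (λ c → T (c ∋ η p)) (sym (lookup-index c∈)) t)) ,
         (λ {p} x → subst (λ c → T (c ∋ η p)) (lookup-index c∈) (⇒ (spec p) x))

-- Transpositions and choice below a bound

open Inverse using (to; from; strictlyInverseˡ; strictlyInverseʳ)

transpose-sends : ∀ {n} (i j : Fin n) → transpose i j ⟨$⟩ʳ i ≡ j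
transpose-sends i j rewrite dec-true (i Fin.≟ i) refl = refl

transpose-below : ∀ {n x} (i j k : Fin n) → toℕ i < x → toℕ j < x → toℕ k < x →
  toℕ (Components.transpose i j k) < x
transpose-below i j k i<x j<x k<x with k Fin.≟ i
... | yes _ = j<x
... | no  _ with k Fin.≟ j
...   | yes _ = i<x
...   | no  _ = k<x

-- The default makes the chosen function total; it serves to give a permutation also on classes that
-- a block does not meet.
choose : ∀ {A : Set} (default : A) {n} x {P : Fin n → A → Set} →
  (∀ i → toℕ i < x → ∃ (P i)) → Σ[ f ∈ (Fin n → A) ] (∀ i → toℕ i < x → P i (f i))
choose {A} default {n} x {P} h = (λ i → proj₁ (value i)) , (λ i → proj₂ (value i))
  where
  value : ∀ i → ∃[ a ] (toℕ i < x → P i a)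
  value i with toℕ i <? x
  ... | yes i<x = let a , p = h i i<x in a , const p
  ... | no  i≮x = default , λ i<x → contradiction i<x i≮x

-- The group `G` as an iterated wreath product

module Geometry (n₁ n₂ n₃ x₁ x₂ x₃ k : ℕ)
  (2≤e₁ : 2 ≤ 2 + n₁) (2≤e₂ : 2 ≤ 2 + n₂) (2≤e₃ : 2 ≤ 2 + n₃) where

  open Parameters (2 + n₁) (2 + n₂) (2 + n₃) k 2≤e₁ 2≤e₂ 2≤e₃
  open IncidenceStructure 𝒟ᶠᵗ

  first : 𝒫 → Fin (2 + n₁)
  first = coord zero
  second : 𝒫 → Fin (2 + n₂)
  second = coord (suc zero)
  third : 𝒫 → Fin (2 + n₃)
  third = coord (suc (suc zero))

  -- The elements of the iterated wreath product.
  record Frame : Set where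
    field
      ρ₁ : Fin (2 + n₂) → Fin (2 + n₃) → Permutation′ (2 + n₁)
      ρ₂ : Fin (2 + n₃) → Permutation′ (2 + n₂)
      ρ₃ : Permutation′ (2 + n₃)

    act : 𝒫 → 𝒫
    act (a , b , c) = ρ₁ b c ⟨$⟩ʳ a , ρ₂ c ⟨$⟩ʳ b , ρ₃ ⟨$⟩ʳ c

    -- The permutations are indexed by source coordinates, so the outer coordinates have to be
    -- undone first.
    act⁻¹ : 𝒫 → 𝒫
    act⁻¹ (a , b , c) = let c′ = ρ₃ ⟨$⟩ˡ c ; b′ = ρ₂ c′ ⟨$⟩ˡ b in ρ₁ b′ c′ ⟨$⟩ˡ a , b′ , c′

    act-act⁻¹ : ∀ p → act (act⁻¹ p) ≡ p
    act-act⁻¹ (a , b , c) = cong₂ _,_ (inverseʳ (ρ₁ _ _)) (cong₂ _,_ (inverseʳ (ρ₂ _)) (inverseʳ ρ₃))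

    act⁻¹-act : ∀ p → act⁻¹ (act p) ≡ p
    act⁻¹-act (a , b , c) rewrite inverseˡ ρ₃ {c} | inverseˡ (ρ₂ c) {b} | inverseˡ (ρ₁ b c) {a} = refl

    bijection : 𝒫 ↔ 𝒫
    bijection = mk↔ₛ′ act act⁻¹ act-act⁻¹ act⁻¹-act

  private
    𝒞₂ : ∀ {p q} → third p ≡ third q → 𝒞 (suc (suc zero)) p q
    𝒞₂ eq zero             (s≤s ())
    𝒞₂ eq (suc zero)       (s≤s (s≤s ()))
    𝒞₂ eq (suc (suc zero)) _ = eq

    𝒞₁ : ∀ {p q} → second p ≡ second q → third p ≡ third q → 𝒞 (suc zero) p q
    𝒞₁ eq₂ eq₃ zero             (s≤s ())
    𝒞₁ eq₂ eq₃ (suc zero)       _ = eq₂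
    𝒞₁ eq₂ eq₃ (suc (suc zero)) _ = eq₃

    𝒞₃ : ∀ {p q} → 𝒞 (suc (suc (suc zero))) p q
    𝒞₃ zero             (s≤s ())
    𝒞₃ (suc zero)       (s≤s (s≤s ()))
    𝒞₃ (suc (suc zero)) (s≤s (s≤s (s≤s ())))

    last₃ : ∀ {p q} → 𝒞 (suc (suc zero)) p q → third p ≡ third q
    last₃ h = h (suc (suc zero)) ≤-refl

    last₂ : ∀ {p q} → 𝒞 (suc zero) p q → second p ≡ second q × third p ≡ third q
    last₂ h = h (suc zero) ≤-refl , h (suc (suc zero)) (s≤s (s≤s z≤n))

    all-equal : ∀ {p q} → 𝒞 zero p q → p ≡ q
    all-equal h = cong₂ _,_ (h zero (s≤s z≤n))
      (cong₂ _,_ (h (suc zero) (s≤s z≤n)) (h (suc (suc zero)) (s≤s z≤n)))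

  frame-∈-G : (𝔣 : Frame) → G (Frame.bijection 𝔣)
  frame-∈-G 𝔣 = λ where
      zero p q → mk⇔ (λ h j _ → cong (coord j ∘ act) (all-equal {p} {q} h))
        (λ h j _ → cong (coord j) (begin
          p               ≡⟨ act⁻¹-act p ⟨
          act⁻¹ (act p)   ≡⟨ cong act⁻¹ (all-equal {act p} {act q} h) ⟩
          act⁻¹ (act q)   ≡⟨ act⁻¹-act q ⟩
          q               ∎))
      (suc zero) (a , b , c) (a′ , b′ , c′) → mk⇔
        (λ h → let b≡b′ , c≡c′ = last₂ {a , b , c} {a′ , b′ , c′} h in
               𝒞₁ {act (a , b , c)} {act (a′ , b′ , c′)}
                 (cong₂ (λ b c → ρ₂ c ⟨$⟩ʳ b) b≡b′ c≡c′) (cong (ρ₃ ⟨$⟩ʳ_) c≡c′))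
        (λ h → let b≡b′ , c≡c′ = last₂ {act (a , b , c)} {act (a′ , b′ , c′)} h in
               𝒞₁ {a , b , c} {a′ , b′ , c′}
                 (injective-second b≡b′ (injective ρ₃ c≡c′)) (injective ρ₃ c≡c′))
      (suc (suc zero)) (a , b , c) (a′ , b′ , c′) → mk⇔
        (λ h → 𝒞₂ {act (a , b , c)} {act (a′ , b′ , c′)}
          (cong (ρ₃ ⟨$⟩ʳ_) (last₃ {a , b , c} {a′ , b′ , c′} h)))
        (λ h → 𝒞₂ {a , b , c} {a′ , b′ , c′}
          (injective ρ₃ (last₃ {act (a , b , c)} {act (a′ , b′ , c′)} h)))
      (suc (suc (suc zero))) p q → mk⇔ (λ _ → 𝒞₃ {act p} {act q}) (λ _ → 𝒞₃ {p} {q})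
    where
    open Frame 𝔣
    open ≡-Reasoning
    injective : ∀ {n} (π : Permutation′ n) {i j} → π ⟨$⟩ʳ i ≡ π ⟨$⟩ʳ j → i ≡ j
    injective π eq = trans (sym (inverseˡ π)) (trans (cong (π ⟨$⟩ˡ_) eq) (inverseˡ π))
    injective-second : ∀ {b b′ c c′} → ρ₂ c ⟨$⟩ʳ b ≡ ρ₂ c′ ⟨$⟩ʳ b′ → c ≡ c′ → b ≡ b′
    injective-second eq refl = injective (ρ₂ _) eq

  G-sym : ∀ {g} → G g → G (↔-sym g)
  G-sym {g} g∈G i p q = mk⇔
    (λ h → ⇐ (g∈G i _ _) (subst₂ (𝒞 i) (sym (strictlyInverseˡ g p)) (sym (strictlyInverseˡ g q)) h))
    (λ h → subst₂ (𝒞 i) (strictlyInverseˡ g p) (strictlyInverseˡ g q) (⇒ (g∈G i _ _) h))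

  G-trans : ∀ {g h} → G g → G h → G (↔-trans g h)
  G-trans g∈G h∈G i p q = mk⇔ (⇒ (h∈G i _ _) ∘ ⇒ (g∈G i p q)) (⇐ (g∈G i p q) ∘ ⇐ (h∈G i _ _))

  module _ (g : 𝒫 ↔ 𝒫) (g∈G : G g) where
    third-cong : ∀ {p q} → third p ≡ third q → third (to g p) ≡ third (to g q)
    third-cong {p} {q} eq = last₃ {to g p} {to g q} (⇒ (g∈G _ p q) (𝒞₂ {p} {q} eq))

    second-cong : ∀ {p q} → second p ≡ second q → third p ≡ third q →
      second (to g p) ≡ second (to g q)
    second-cong {p} {q} eq₂ eq₃ = proj₁ (last₂ {to g p} {to g q} (⇒ (g∈G _ p q) (𝒞₁ {p} {q} eq₂ eq₃)))

  -- Invariance of `𝒞` at 2 and 1 makes the third coordinate of an image depend on the third alone,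
  -- and the second on the last two; the permutations are read off at points padded with zeros. The
  -- inverse of `g` also lies in `G` and supplies their inverses.
  module FrameOf (g : 𝒫 ↔ 𝒫) (g∈G : G g) where
    private
      F H : 𝒫 → 𝒫
      F = to g
      H = from g
      F∘H : ∀ p → F (H p) ≡ p
      F∘H = strictlyInverseˡ g
      H∘F : ∀ p → H (F p) ≡ p
      H∘F = strictlyInverseʳ g
      F₃ = third-cong g g∈G
      F₂ = second-cong g g∈G
      H₃ = third-cong (↔-sym g) (G-sym {g} g∈G)
      H₂ = second-cong (↔-sym g) (G-sym {g} g∈G)

      r₃ : Fin (2 + n₃) → Fin (2 + n₃)
      r₃ c = third (F (zero , zero , c))
      r₂ : Fin (2 + n₃) → Fin (2 + n₂) → Fin (2 + n₂)
      r₂ c b = second (F (zero , b , c))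

      F-shape : ∀ a b c → F (a , b , c) ≡ (first (F (a , b , c)) , r₂ c b , r₃ c)
      F-shape a b c = cong (first (F (a , b , c)) ,_)
        (cong₂ _,_ (F₂ {a , b , c} {zero , b , c} refl refl) (F₃ {a , b , c} {zero , zero , c} refl))

      H-third : ∀ a b c → third (H (a , b , r₃ c)) ≡ c
      H-third a b c = trans
        (H₃ {a , b , r₃ c} {F (zero , zero , c)} refl) (cong third (H∘F (zero , zero , c)))

      H-second : ∀ a b c → second (H (a , r₂ c b , r₃ c)) ≡ b
      H-second a b c = trans
        (H₂ {a , r₂ c b , r₃ c} {F (zero , b , c)} refl (F₃ {zero , zero , c} {zero , b , c} refl))
        (cong second (H∘F (zero , b , c)))

      H-shape : ∀ a b c → H (a , r₂ c b , r₃ c) ≡ (first (H (a , r₂ c b , r₃ c)) , b , c)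
      H-shape a b c = cong (first (H (a , r₂ c b , r₃ c)) ,_)
        (cong₂ _,_ (H-second a b c) (H-third a (r₂ c b) c))

    frame : Frame
    frame = record
      { ρ₃ = permutation r₃ (λ c → third (H (zero , zero , c)))
          (λ c → trans (F₃ {q = H (zero , zero , c)} refl) (cong third (F∘H (zero , zero , c))))
          (H-third zero zero)
      ; ρ₂ = λ c → permutation (r₂ c) (λ b → second (H (zero , b , r₃ c)))
          (λ b → trans (F₂ {q = H (zero , b , r₃ c)} refl (sym (H-third zero b c)))
                       (cong second (F∘H (zero , b , r₃ c))))
          (λ b → H-second zero b c)
      ; ρ₁ = λ b c → permutation (λ a → first (F (a , b , c))) (λ a → first (H (a , r₂ c b , r₃ c)))
          (λ a → cong first (trans (cong F (sym (H-shape a b c))) (F∘H (a , r₂ c b , r₃ c))))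
          (λ a → cong first (trans (cong H (sym (F-shape a b c))) (H∘F (a , b , c))))
      }

    act-frame : ∀ p → to g p ≡ Frame.act frame p
    act-frame (a , b , c) = F-shape a b c

  -- `B` with integer bounds: the ratios of consecutive `y` will be `2 + xᵢ`. Agreement with `B` is
  -- a hypothesis here and is derived from the numerical conditions later, which keeps rationals out
  -- of the geometry.
  Box : Pred 𝒫 0ℓ
  Box (a , b , c) = toℕ a < 2 + x₁ × toℕ b < 2 + x₂ × toℕ c < 2 + x₃

  -- Chain-imprimitivity and flag-transitivity

  module _ (B≐Box : B ≐ Box) (x₁≤n₁ : x₁ ≤ n₁) (x₂≤n₂ : x₂ ≤ n₂) (x₃≤n₃ : x₃ ≤ n₃) where

    -- Testing `p` at its preimage avoids the existential in `B ^ g`.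
    IsImage : Pred 𝒫 0ℓ → 𝒫 ↔ 𝒫 → Set
    IsImage X g = ∀ p → X p ⇔ Box (from g p)

    image⇒IsImage : ∀ {X} g → X ≐ (B ^ g) → IsImage X g
    image⇒IsImage g (X⊆ , ⊆X) p = mk⇔
      (λ Xp → let q , q∈B , gq≡p = X⊆ Xp in
              subst Box (sym (trans (cong (from g) (sym gq≡p)) (strictlyInverseʳ g q)))
                (proj₁ B≐Box q∈B))
      (λ b → ⊆X (from g p , proj₂ B≐Box b , strictlyInverseˡ g p))

    IsImage⇒image : ∀ {X} g → IsImage X g → X ≐ (B ^ g)
    IsImage⇒image {X} g eq =
      (λ {p} Xp → from g p , proj₂ B≐Box (⇒ (eq p) Xp) , strictlyInverseˡ g p) ,
      (λ (q , q∈B , gq≡p) → subst X gq≡p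
        (⇐ (eq (to g q)) (subst Box (sym (strictlyInverseʳ g q)) (proj₁ B≐Box q∈B))))

    chain-imprimitive : IsFlagTransitiveChainImprimitive 𝒟ᶠᵗ G 𝒞
    chain-imprimitive = record
      { automorphisms   = λ g g∈G X → mk⇔ (push g g∈G X) (pull g g∈G X)
      ; flagTransitive  = flag-transitive
      ; pointTransitive = λ p q → let 𝔣 = swapping p q in
          Frame.bijection 𝔣 , frame-∈-G 𝔣 , swapping-sends p q
      ; chainInvariant  = λ g g∈G → g∈G
      }
      where
      push : ∀ g → G g → ∀ X → 𝓑 X → 𝓑 (X ^ g)
      push g g∈G X (h , h∈G , X≐Bʰ) = ↔-trans h g , G-trans {h} {g} h∈G g∈G ,
        IsImage⇒image (↔-trans h g) λ p → mk⇔
          (λ (q , Xq , gq≡p) → subst (Box ∘ from h)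
            (trans (sym (strictlyInverseʳ g q)) (cong (from g) gq≡p))
            (⇒ (image⇒IsImage h X≐Bʰ q) Xq))
          (λ b → from g p , ⇐ (image⇒IsImage h X≐Bʰ (from g p)) b , strictlyInverseˡ g p)

      pull : ∀ g → G g → ∀ X → 𝓑 (X ^ g) → 𝓑 X
      pull g g∈G X (h , h∈G , Xᵍ≐Bʰ) =
        ↔-trans h (↔-sym g) , G-trans {h} {↔-sym g} h∈G (G-sym {g} g∈G) ,
        IsImage⇒image (↔-trans h (↔-sym g)) λ p → mk⇔
          (λ Xp → ⇒ (image⇒IsImage h Xᵍ≐Bʰ (to g p)) (p , Xp , refl))
          (λ b → let q , Xq , gq≡gp = ⇐ (image⇒IsImage h Xᵍ≐Bʰ (to g p)) b in
                 subst X (trans (sym (strictlyInverseʳ g q))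
                           (trans (cong (from g) gq≡gp) (strictlyInverseʳ g p))) Xq)

      swapping : 𝒫 → 𝒫 → Frame
      swapping (a , b , c) (a′ , b′ , c′) = record
        { ρ₁ = λ _ _ → transpose a a′ ; ρ₂ = λ _ → transpose b b′ ; ρ₃ = transpose c c′ }

      swapping-sends : ∀ p q → Frame.act (swapping p q) p ≡ q
      swapping-sends (a , b , c) (a′ , b′ , c′) =
        cong₂ _,_ (transpose-sends a a′) (cong₂ _,_ (transpose-sends b b′) (transpose-sends c c′))

      swapping-Box : ∀ p q r → Box p → Box q → Box r → Box (Frame.act (swapping p q) r)
      swapping-Box (a , b , c) (a′ , b′ , c′) (a″ , b″ , c″)
        (p₁ , p₂ , p₃) (q₁ , q₂ , q₃) (r₁ , r₂ , r₃) =
        transpose-below a a′ a″ p₁ q₁ r₁ , transpose-below b b′ b″ p₂ q₂ r₂ ,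
        transpose-below c c′ c″ p₃ q₃ r₃

      flag-transitive : ∀ p X q Y → 𝓑 X → X p → 𝓑 Y → Y q → ∃[ g ] G g × to g p ≡ q × (X ^ g) ≐ Y
      flag-transitive p X q Y (g , g∈G , X≐Bᵍ) Xp (h , h∈G , Y≐Bʰ) Yq =
        τ , τ∈G , τp≡q ,
        ((λ (r , Xr , τr≡s) → subst Y τr≡s (⇐ (Y-image (to τ r))
            (subst Box (sym (strictlyInverseʳ h (act (from g r))))
              (swapping-Box p₀ q₀ (from g r) p₀∈ q₀∈ (⇒ (X-image r) Xr))))) ,
         (λ {s} Ys → from τ s , ⇐ (X-image (from τ s))
            (subst Box (sym (strictlyInverseʳ g (act⁻¹ (from h s))))
              -- The inverse of `swapping p₀ q₀` acts by computation as `swapping q₀ p₀`, hence the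
              -- exchanged arguments.
              (swapping-Box q₀ p₀ (from h s) q₀∈ p₀∈ (⇒ (Y-image s) Ys))) ,
            strictlyInverseˡ τ s))
        where
        X-image = image⇒IsImage g X≐Bᵍ
        Y-image = image⇒IsImage h Y≐Bʰ
        p₀ q₀ : 𝒫
        p₀ = from g p
        q₀ = from h q
        p₀∈ : Box p₀
        p₀∈ = ⇒ (X-image p) Xp
        q₀∈ : Box q₀
        q₀∈ = ⇒ (Y-image q) Yq
        open Frame (swapping p₀ q₀)
        -- Pull `X` back to the box by `g`, move `p₀` to `q₀` inside the box, and carry the box to
        -- `Y` by `h`.
        τ : 𝒫 ↔ 𝒫
        τ = ↔-trans (↔-sym g) (↔-trans bijection h)
        τ∈G : G τ
        τ∈G = G-trans {↔-sym g} {↔-trans bijection h} (G-sym {g} g∈G)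
          (G-trans {bijection} {h} (frame-∈-G (swapping p₀ q₀)) h∈G)
        τp≡q : to τ p ≡ q
        τp≡q = trans (cong (to h) (swapping-sends p₀ q₀)) (strictlyInverseˡ h q)

    -- The size of a block

    block-size : ∀ X → 𝓑 X → HasCardinality (setoid 𝒫) X ((2 + x₁) * ((2 + x₂) * (2 + x₃)))
    block-size X (g , g∈G , X≐Bᵍ) = record
      { to        = λ (p , Xp) → number p (⇒ (image p) Xp)
      ; from      = λ i → point i ,
                    ⇐ (image (point i)) (subst Box (sym (strictlyInverseʳ g (corner i))) (corner∈Box i))
      -- Membership proofs enter `number` only through the irrelevant argument of `fromℕ<`.
      ; to-cong   = λ { {p , _} {_ , _} refl → refl }
      ; from-cong = cong point
      ; inverse   = (λ { {i} {_ , Xp} refl → number∘point i (⇒ (image (point i)) Xp) }) ,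
                    (λ { {p , Xp} refl → point∘number p (⇒ (image p) Xp) })
      }
      where
      image = image⇒IsImage g X≐Bᵍ
      I : Set
      I = Fin ((2 + x₁) * ((2 + x₂) * (2 + x₃)))
      lex : (Fin (2 + x₁) × Fin (2 + x₂) × Fin (2 + x₃)) ↔ I
      lex = ↔-sym (↔-trans (Fin.*↔× {2 + x₁} {(2 + x₂) * (2 + x₃)})
                           (↔-refl ×-↔ Fin.*↔× {2 + x₂} {2 + x₃}))

      cut : ∀ p → Box p → Fin (2 + x₁) × Fin (2 + x₂) × Fin (2 + x₃)
      cut _ (a<x , b<x , c<x) = fromℕ< a<x , fromℕ< b<x , fromℕ< c<x

      number : ∀ p → Box (from g p) → I
      number p b = to lex (cut (from g p) b)

      inject : Fin (2 + x₁) × Fin (2 + x₂) × Fin (2 + x₃) → 𝒫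
      inject (a , b , c) =
        inject≤ a (s≤s (s≤s x₁≤n₁)) , inject≤ b (s≤s (s≤s x₂≤n₂)) , inject≤ c (s≤s (s≤s x₃≤n₃))

      corner : I → 𝒫
      corner i = inject (from lex i)

      below : ∀ {m n} (i : Fin m) .(m≤n : m ≤ n) → toℕ (inject≤ i m≤n) < m
      below {m} i m≤n = subst (_< m) (sym (Fin.toℕ-inject≤ i m≤n)) (Fin.toℕ<n i)

      corner∈Box : ∀ i → Box (corner i)
      corner∈Box i = let a , b , c = from lex i in
        below a (s≤s (s≤s x₁≤n₁)) , below b (s≤s (s≤s x₂≤n₂)) , below c (s≤s (s≤s x₃≤n₃))

      point : I → 𝒫
      point i = to g (corner i)

      fromℕ<-inject≤ : ∀ {m n} (i : Fin m) .(m≤n : m ≤ n) .(i<m : toℕ (inject≤ i m≤n) < m) →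
        fromℕ< i<m ≡ i
      fromℕ<-inject≤ i m≤n i<m = Fin.toℕ-injective
        (trans (Fin.toℕ-fromℕ< i<m) (Fin.toℕ-inject≤ i m≤n))

      inject≤-fromℕ< : ∀ {m n} (i : Fin n) .(m≤n : m ≤ n) .(i<m : toℕ i < m) →
        inject≤ (fromℕ< i<m) m≤n ≡ i
      inject≤-fromℕ< i m≤n i<m = Fin.toℕ-injective
        (trans (Fin.toℕ-inject≤ (fromℕ< i<m) m≤n) (Fin.toℕ-fromℕ< i<m))

      cut-inject : ∀ t p → p ≡ inject t → (b : Box p) → cut p b ≡ t
      cut-inject (a , b , c) _ refl (a< , b< , c<) =
        cong₂ _,_ (fromℕ<-inject≤ a _ a<) (cong₂ _,_ (fromℕ<-inject≤ b _ b<) (fromℕ<-inject≤ c _ c<))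

      inject-cut : ∀ p b → inject (cut p b) ≡ p
      inject-cut (a , b , c) (a< , b< , c<) =
        cong₂ _,_ (inject≤-fromℕ< a _ a<) (cong₂ _,_ (inject≤-fromℕ< b _ b<) (inject≤-fromℕ< c _ c<))

      number∘point : ∀ i b → number (point i) b ≡ i
      number∘point i b = trans
        (cong (to lex) (cut-inject (from lex i) (from g (point i)) (strictlyInverseʳ g (corner i)) b))
        (strictlyInverseˡ lex i)

      point∘number : ∀ p b → point (number p b) ≡ p
      point∘number p b = trans
        (cong (to g) (trans (cong inject (strictlyInverseʳ lex (cut (from g p) b)))
                            (inject-cut (from g p) b)))
        (strictlyInverseˡ g p)

    -- Blocks as members of an iterated wreath family

    private
      family₁ = Wreath.wreath singleton (2 + n₁) (2 + x₁) (s≤s z≤n) (s≤s (s≤s x₁≤n₁))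
      family₂ = Wreath.wreath family₁ (2 + n₂) (2 + x₂) (s≤s z≤n) (s≤s (s≤s x₂≤n₂))
      family₃ = Wreath.wreath family₂ (2 + n₃) (2 + x₃) (s≤s z≤n) (s≤s (s≤s x₃≤n₃))

      -- The families grow from the first coordinate outwards over a one-point base, hence the left
      -- nesting and the unit.
      nest : 𝒫 → ((⊤ × Fin (2 + n₁)) × Fin (2 + n₂)) × Fin (2 + n₃)
      nest (a , b , c) = ((tt , a) , b) , c

      flatten : ((⊤ × Fin (2 + n₁)) × Fin (2 + n₂)) × Fin (2 + n₃) → 𝒫
      flatten (((_ , a) , b) , c) = a , b , c

    Framed : Pred 𝒫 0ℓ → Set
    Framed X = Σ[ 𝔣 ∈ Frame ] ∀ p → X (Frame.act 𝔣 p) ⇔ Box p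

    𝓑⇒Framed : ∀ {X} → 𝓑 X → Framed X
    𝓑⇒Framed {X} (g , g∈G , X≐Bᵍ) = frame , λ p →
      subst₂ (λ q r → X q ⇔ Box r) (act-frame p) (strictlyInverseʳ g p) (image⇒IsImage g X≐Bᵍ (to g p))
      where open FrameOf g g∈G

    Framed⇒𝓑 : ∀ {X} → Framed X → 𝓑 X
    Framed⇒𝓑 {X} (𝔣 , eq) = bijection , frame-∈-G 𝔣 , IsImage⇒image bijection λ p →
      subst (λ q → X q ⇔ Box (act⁻¹ p)) (act-act⁻¹ p) (eq (act⁻¹ p))
      where open Frame 𝔣

    Framed⇒Block : ∀ {X} → Framed X → Family.Block family₃ (X ∘ flatten)
    Framed⇒Block {X} (𝔣 , eq) = ρ₃ , λ c →
      (λ c<x → ρ₂ c , λ b →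
        (λ b<x → ρ₁ b c , λ a →
          (λ a<x → ⇐ (eq (a , b , c)) (a<x , b<x , c<x)) ,
          (λ x≤a _ X∋ → <⇒≱ (proj₁ (⇒ (eq (a , b , c)) X∋)) x≤a)) ,
        (λ x≤b (_ , a) X∋ → <⇒≱ (proj₁ (proj₂ (⇒ (eq _) (at-first a b c X∋)))) x≤b)) ,
      (λ x≤c ((_ , a) , b) X∋ → <⇒≱ (proj₂ (proj₂ (⇒ (eq _) (at-second a b c X∋)))) x≤c)
      where
      open Frame 𝔣
      -- To show that `X` misses a class, any point of the class is rewritten as the image of its
      -- preimage, where the equivalence with `Box` applies.
      at-first : ∀ a b c → X (a , ρ₂ c ⟨$⟩ʳ b , ρ₃ ⟨$⟩ʳ c) → X (act (ρ₁ b c ⟨$⟩ˡ a , b , c))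
      at-first a b c = subst (λ a′ → X (a′ , ρ₂ c ⟨$⟩ʳ b , ρ₃ ⟨$⟩ʳ c)) (sym (inverseʳ (ρ₁ b c)))
      at-second : ∀ a b c → X (a , b , ρ₃ ⟨$⟩ʳ c) →
        X (act (ρ₁ (ρ₂ c ⟨$⟩ˡ b) c ⟨$⟩ˡ a , ρ₂ c ⟨$⟩ˡ b , c))
      at-second a b c X∋ = at-first a (ρ₂ c ⟨$⟩ˡ b) c
        (subst (λ b′ → X (a , b′ , ρ₃ ⟨$⟩ʳ c)) (sym (inverseʳ (ρ₂ c))) X∋)

    Block⇒Framed : ∀ {X} → Family.Block family₃ (X ∘ flatten) → Framed X
    Block⇒Framed {X} (ρ₃ , block₃) = 𝔣 , λ (a , b , c) → mk⇔ (inside a b c) (outside a b c)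
      where
      -- A wreath block supplies permutations only over the classes it meets; elsewhere the identity
      -- is as good, since no point of `X` lies there.
      second-level = choose Perm.id (2 + x₃) (λ c c<x → proj₁ (block₃ c) c<x)
      first-level = choose (λ _ → Perm.id) (2 + x₃) λ c c<x →
        choose Perm.id (2 + x₂) λ b b<x → proj₁ (proj₂ second-level c c<x b) b<x
      𝔣 : Frame
      𝔣 = record { ρ₁ = λ b c → proj₁ first-level c b ; ρ₂ = proj₁ second-level ; ρ₃ = ρ₃ }
      open Frame 𝔣 using (act)
      inside : ∀ a b c → X (act (a , b , c)) → Box (a , b , c)
      inside a b c X∋ = ≰⇒> (λ x≤a → proj₂ (proj₂ first-level c c<x b b<x a) x≤a tt X∋) , b<x , c<x
        where
        -- The bounds are obtained from the outside in: each one makes the data of the next level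
        -- available.
        c<x : toℕ c < 2 + x₃
        c<x = ≰⇒> λ x≤c → proj₂ (block₃ c) x≤c _ X∋
        b<x : toℕ b < 2 + x₂
        b<x = ≰⇒> λ x≤b → proj₂ (proj₂ second-level c c<x b) x≤b _ X∋
      outside : ∀ a b c → Box (a , b , c) → X (act (a , b , c))
      outside a b c (a<x , b<x , c<x) = proj₁ (proj₂ first-level c c<x b b<x a) a<x

    -- The proportions of `WreathBalanced` at levels two and three, where (κ + 1, u + 1) is (y₁, e₁)
    -- and (y₂, e₁ e₂) respectively.
    module _ (proportion₂ : suc x₁ * suc n₂ * (2 + n₁) ≡ suc x₂ * (2 + x₁) * suc n₁)
             (proportion₃ :
                (suc x₁ + (2 + x₁) * suc x₂) * suc n₃ * suc (suc n₁ + (2 + n₁) * suc n₂) ≡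
                suc x₃ * suc (suc x₁ + (2 + x₁) * suc x₂) * (suc n₁ + (2 + n₁) * suc n₂)) where

      family₃-balanced : Balanced family₃ _ _
      family₃-balanced = WreathBalanced.wreath-balanced balanced₂ n₃ x₃ (s≤s (s≤s x₃≤n₃)) proportion₃
        where
        balanced₁ : Balanced family₁ (suc x₁) (suc n₁)
        -- Over the one-point family `κ = u = 0`, so the proportion reads 0 = 0.
        balanced₁ = subst₂ (Balanced family₁) (+-identityʳ (suc x₁)) (+-identityʳ (suc n₁))
          (WreathBalanced.wreath-balanced singleton-balanced n₁ x₁ (s≤s (s≤s x₁≤n₁))
            (sym (*-zeroʳ (suc x₁ * 1))))
        balanced₂ : Balanced family₂ (suc x₁ + (2 + x₁) * suc x₂) (suc n₁ + (2 + n₁) * suc n₂)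
        balanced₂ = WreathBalanced.wreath-balanced balanced₁ n₂ x₂ (s≤s (s≤s x₂≤n₂)) proportion₂

      2-design : Is2Design 𝒟ᶠᵗ
      2-design = record
        { nonempty = B , ↔-refl , (λ i p q → mk⇔ (λ h → h) (λ h → h)) ,
                     (λ {p} p∈B → p , p∈B , refl) , (λ (p , p∈B , p≡q) → subst B p≡q p∈B)
        ; uniform  = (2 + x₁) * ((2 + x₂) * (2 + x₃)) , block-size
        ; balanced = Balanced.l family₃-balanced , λ p q p≢q →
            subst (HasCardinality _ _)
              (Balanced.pair-count family₃-balanced (nest p) (nest q) (p≢q ∘ cong flatten))
              (blocks-through nest (λ q → flatten q , refl) family₃
                (λ {X} b → let c , c∈ , spec = encode (Framed⇒Block {X} (𝓑⇒Framed b)) in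
                           c , c∈ , λ p → spec (nest p))
                (λ {c} c∈ → Framed⇒𝓑 (Block⇒Framed {λ p → T (c ∋ nest p)} (decode c∈))) p q)
        }
        where open Family family₃ using (_∋_; encode; decode)

-- Clearing denominators in the rational conditions

toℚᵘ-/ : ∀ z n → toℚᵘ (z ℚ./ suc n) ≃ mkℚᵘ z n
toℚᵘ-/ z n = ℚ.toℚᵘ-fromℚᵘ (mkℚᵘ z n)

-- Unnormalised rationals, unlike reduced fractions, compute with variable numerators and
-- denominators, so equality becomes cross-multiplication.
1+m/n*o-≃ : ∀ m n o → toℚᵘ (1ℚ ℚ.+ (+ m ℚ./ suc n) ℚ.* (+ o ℚ./ 1)) ≃ mkℚᵘ (+ (suc n + m * o)) n
1+m/n*o-≃ m n o = begin
  toℚᵘ (1ℚ ℚ.+ (+ m ℚ./ suc n) ℚ.* (+ o ℚ./ 1))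
    ≈⟨ ℚ.toℚᵘ-homo-+ 1ℚ ((+ m ℚ./ suc n) ℚ.* (+ o ℚ./ 1)) ⟩
  1ℚᵘ ℚᵘ.+ toℚᵘ ((+ m ℚ./ suc n) ℚ.* (+ o ℚ./ 1))
    ≈⟨ ℚᵘ.+-congʳ 1ℚᵘ (ℚ.toℚᵘ-homo-* (+ m ℚ./ suc n) (+ o ℚ./ 1)) ⟩
  1ℚᵘ ℚᵘ.+ toℚᵘ (+ m ℚ./ suc n) ℚᵘ.* toℚᵘ (+ o ℚ./ 1)
    ≈⟨ ℚᵘ.+-congʳ 1ℚᵘ (ℚᵘ.*-cong (toℚᵘ-/ (+ m) n) (toℚᵘ-/ (+ o) 0)) ⟩
  1ℚᵘ ℚᵘ.+ mkℚᵘ (+ m) n ℚᵘ.* mkℚᵘ (+ o) 0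
    ≈⟨ *≡* numerators ⟩
  mkℚᵘ (+ (suc n + m * o)) n ∎
  where
  open import Relation.Binary.Reasoning.Setoid ℚᵘ.≃-setoid
  alg : ∀ n m o → (+ 1 ℤ.* n ℤ.+ (m ℤ.* o) ℤ.* + 1) ℤ.* n ≡ (n ℤ.+ m ℤ.* o) ℤ.* n
  alg = ℤ.solve-∀
  numerator : ∀ d → (+ 1 ℤ.* + d ℤ.+ (+ m ℤ.* + o) ℤ.* + 1) ℤ.* + d ≡ + (d + m * o) ℤ.* + d
  numerator d = trans (alg (+ d) (+ m) (+ o)) (cong (λ z → (+ d ℤ.+ z) ℤ.* + d) (sym (ℤ.pos-* m o)))
  numerators : (+ 1 ℤ.* + (suc n * 1) ℤ.+ (+ m ℤ.* + o) ℤ.* + 1) ℤ.* + suc n ≡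
               + (suc n + m * o) ℤ.* + (1 * (suc n * 1))
  -- The denominators `suc n * 1` and `1 * (suc n * 1)` produced by the rational operations are
  -- first reduced to `suc n`.
  numerators = subst₂
    (λ p q → (+ 1 ℤ.* + p ℤ.+ (+ m ℤ.* + o) ℤ.* + 1) ℤ.* + suc n ≡ + (suc n + m * o) ℤ.* + q)
    (sym (*-identityʳ (suc n)))
    (sym (trans (*-identityˡ (suc n * 1)) (*-identityʳ (suc n)))) (numerator (suc n))

1+m/n*o≡z⇔ : ∀ m n o z .{{_ : NonZero n}} →
  1ℚ ℚ.+ (+ m ℚ./ n) ℚ.* (+ o ℚ./ 1) ≡ z ℚ./ 1 ⇔ + (n + m * o) ≡ z ℤ.* + n
1+m/n*o≡z⇔ m (suc n) o z = mk⇔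
  (λ eq → trans (sym (ℤ.*-identityʳ _)) (ℚᵘ.drop-*≡*
            (ℚᵘ.≃-trans (ℚᵘ.≃-sym (1+m/n*o-≃ m n o)) (ℚᵘ.≃-trans (ℚ.toℚᵘ-cong eq) (toℚᵘ-/ z 0)))))
  (λ eq → ℚ.toℚᵘ-injective (ℚᵘ.≃-trans (1+m/n*o-≃ m n o)
            (ℚᵘ.≃-trans (*≡* (trans (ℤ.*-identityʳ _) eq)) (ℚᵘ.≃-sym (toℚᵘ-/ z 0)))))

integer-nonZero : ∀ {q} b .{{_ : NonZero b}} → q ≡ + b ℚ./ 1 → ℚ.NonZero q
integer-nonZero b refl = ℚ.pos⇒nonZero (+ b ℚ./ 1) {{ℚ.normalize-pos b 1}}

-- The nonzero proof is an irrelevant argument of `_÷_`, so the result applies to `ratio`, which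
-- carries a different proof.
quotient-of-integers : ∀ {p q} a b x .{{_ : NonZero b}} →
  p ≡ + a ℚ./ 1 → (q≡ : q ≡ + b ℚ./ 1) → a ≡ b * x →
  (p ÷ q) {{integer-nonZero b q≡}} ≡ + x ℚ./ 1
quotient-of-integers {p} {q} _ b x p≡ q≡ refl = begin
  p ℚ.* ℚ.1/ q                           ≡⟨ cong (ℚ._* ℚ.1/ q) (trans p≡ product) ⟩
  (+ x ℚ./ 1) ℚ.* (+ b ℚ./ 1) ℚ.* ℚ.1/ q ≡⟨ cong (λ z → (+ x ℚ./ 1) ℚ.* z ℚ.* ℚ.1/ q) (sym q≡) ⟩
  (+ x ℚ./ 1) ℚ.* q ℚ.* ℚ.1/ q           ≡⟨ ℚ.*-assoc (+ x ℚ./ 1) q (ℚ.1/ q) ⟩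
  (+ x ℚ./ 1) ℚ.* (q ℚ.* ℚ.1/ q)         ≡⟨ cong ((+ x ℚ./ 1) ℚ.*_) (ℚ.*-inverseʳ q) ⟩
  (+ x ℚ./ 1) ℚ.* 1ℚ                     ≡⟨ ℚ.*-identityʳ (+ x ℚ./ 1) ⟩
  + x ℚ./ 1                              ∎
  where
  open ≡-Reasoning
  instance
    q≢0 : ℚ.NonZero q
    q≢0 = integer-nonZero b q≡
  product : + (b * x) ℚ./ 1 ≡ (+ x ℚ./ 1) ℚ.* (+ b ℚ./ 1)
  product = ℚ.toℚᵘ-injective (ℚᵘ.≃-trans (toℚᵘ-/ (+ (b * x)) 0) (ℚᵘ.≃-sym
    (ℚᵘ.≃-trans (ℚ.toℚᵘ-homo-* (+ x ℚ./ 1) (+ b ℚ./ 1))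
      (ℚᵘ.≃-trans (ℚᵘ.*-cong (toℚᵘ-/ (+ x) 0) (toℚᵘ-/ (+ b) 0))
        (*≡* (cong (ℤ._* + 1) (trans (sym (ℤ.pos-* x b)) (cong +_ (*-comm x b)))))))))

i/1≤x/1-1⇔ : ∀ i x → (+ i ℚ./ 1) ℚ.≤ (+ suc x ℚ./ 1) ℚ.- 1ℚ ⇔ i < suc x
i/1≤x/1-1⇔ i x = mk⇔
  (λ le → s≤s (ℤ.drop‿+≤+ (ℤ.*-cancelʳ-≤-pos (+ i) (+ x) (+ 1) (ℚᵘ.drop-*≤*
            (ℚᵘ.≤-respˡ-≃ (toℚᵘ-/ (+ i) 0) (ℚᵘ.≤-respʳ-≃ predecessor (ℚ.toℚᵘ-mono-≤ le)))))))
  (λ { (s≤s le) → ℚ.toℚᵘ-cancel-≤ (ℚᵘ.≤-respˡ-≃ (ℚᵘ.≃-sym (toℚᵘ-/ (+ i) 0))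
       (ℚᵘ.≤-respʳ-≃ (ℚᵘ.≃-sym predecessor) (*≤* (ℤ.*-monoʳ-≤-nonNeg (+ 1) (ℤ.+≤+ le))))) })
  where
  predecessor : toℚᵘ ((+ suc x ℚ./ 1) ℚ.- 1ℚ) ≃ mkℚᵘ (+ x) 0
  predecessor = ℚᵘ.≃-trans (ℚ.toℚᵘ-homo-+ (+ suc x ℚ./ 1) (ℚ.- 1ℚ))
    (ℚᵘ.≃-trans (ℚᵘ.+-congˡ (toℚᵘ (ℚ.- 1ℚ)) (toℚᵘ-/ (+ suc x) 0)) (*≡* (cong (ℤ._* + 1) (alg x))))
    where
    alg : ∀ x → + suc x ℤ.* + 1 ℤ.+ ℤ.- (+ 1) ℤ.* + 1 ≡ + x
    alg x rewrite *-identityʳ x = refl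

-- Reduction of the conditions to a finite search

_≟⁴_ : (s t : ℕ × ℕ × ℕ × ℕ) → Dec (s ≡ t)
_≟⁴_ = ≡-dec _≟_ (≡-dec _≟_ (≡-dec _≟_ _≟_))

open import Data.List.Membership.DecPropositional _≟⁴_ using (_∈?_)

side : ℕ → ℕ → ℕ
side d a = suc (d * a)

w₂ : ℕ → ℕ → ℕ → ℕ
w₂ d a₁ a₂ = a₁ + a₂ * side d a₁

w₃ : ℕ → ℕ → ℕ → ℕ → ℕ
w₃ d a₁ a₂ a₃ = w₂ d a₁ a₂ + a₃ * (side d a₁ * side d a₂)

-- If eᵢ = side d aᵢ, then e₁ e₂ - 1 = d w₂, v - 1 = d w₃, k - 1 = m w₃, y₁ = 1 + m a₁ and
-- y₂ = 1 + m w₂. That the aᵢ are coprime turns out not to matter for the search.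
Listed : Set
Listed = ∀ {d-1} → d-1 < 49 → let d = suc d-1 ; bound = 49 / d in
  ∀ {a₁-1} → a₁-1 < bound → ∀ {a₂-1} → a₂-1 < bound → ∀ {m-1} → m-1 < d-1 →
  let a₁ = suc a₁-1 ; a₂ = suc a₂-1 ; m = suc m-1 in
  suc (m * a₁) ∣ a₂ * side d a₁ → ∀ {a₃-1} → a₃-1 < bound → let a₃ = suc a₃-1 in
  suc (m * w₂ d a₁ a₂) ∣ a₃ * (side d a₁ * side d a₂) →
  (side d a₁ , side d a₂ , side d a₃ , suc (m * w₃ d a₁ a₂ a₃)) ∈ tuples

-- The divisibility by `y₁` is tested before `a₃` is introduced, so the innermost search runs only
-- where that test succeeds.
listed? : Dec Listed
listed? = allUpTo? (λ d → allUpTo? (λ a₁ → allUpTo? (λ a₂ → allUpTo? (λ m →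
  (_ ∣? _) →-dec allUpTo? (λ a₃ → (_ ∣? _) →-dec (_ ∈? tuples)) _) _) _) _) _

listed : Listed
listed = toWitness {a? = listed?} tt

-- Conditions (1)–(3) with the denominators of y₁ and y₂ and the divisions by d cleared.
record NumericConditions (e₁ e₂ e₃ k d y₁ y₂ : ℕ) : Set where
  constructor numeric
  v : ℕ
  v = e₁ * e₂ * e₃
  field
    v-1∣  : (v ∸ 1) ∣ (k ∸ 1) * d
    y₁-eq : v ∸ 1 + (k ∸ 1) * (e₁ ∸ 1) ≡ y₁ * (v ∸ 1)
    y₂-eq : v ∸ 1 + (k ∸ 1) * (e₁ * e₂ ∸ 1) ≡ y₂ * (v ∸ 1)
    y₁∣   : y₁ * d ∣ (e₂ ∸ 1) * e₁
    y₂∣   : y₂ * d ∣ (e₃ ∸ 1) * e₁ * e₂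

numericConditions? : ∀ e₁ e₂ e₃ k d y₁ y₂ → Dec (NumericConditions e₁ e₂ e₃ k d y₁ y₂)
numericConditions? e₁ e₂ e₃ k d y₁ y₂ = map′
  (λ (p , q , r , s , t) → numeric p q r s t) (λ (numeric p q r s t) → p , q , r , s , t)
  ((_ ∣? _) ×-dec (_ ≟ _) ×-dec (_ ≟ _) ×-dec (_ ∣? _) ×-dec (_ ∣? _))

-- The quotient `q` in condition (1) satisfies k - 1 = q w₃; k < v forces q < d, and k > 1 excludes
-- q = 0. So `q` is the `m` of the search, `y₁` and `y₂` are 1 + q a₁ and 1 + q w₂, and `d` cancels
-- from both divisibilities.
reduced-listed : ∀ d-1 a₁-1 a₂-1 a₃-1 k y₁ y₂ →
  let d = suc d-1 ; a₁ = suc a₁-1 ; a₂ = suc a₂-1 ; a₃ = suc a₃-1 in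
  d-1 < 49 → a₁-1 < 49 / d → a₂-1 < 49 / d → a₃-1 < 49 / d →
  1 < k → k < side d a₁ * side d a₂ * side d a₃ →
  NumericConditions (side d a₁) (side d a₂) (side d a₃) k d y₁ y₂ →
  (side d a₁ , side d a₂ , side d a₃ , k) ∈ tuples
reduced-listed d-1 a₁-1 a₂-1 a₃-1 k@(suc k-1) y₁ y₂ d< a₁< a₂< a₃< (s≤s 0<k-1) k<v
  (numeric (divides q k-1*d≡) y₁≡ y₂≡ y₁∣ y₂∣) =
  conclude q k-1≡ q<d y₁≡′ y₂≡′
  where
  open ≡-Reasoning
  d = suc d-1
  a₁ = suc a₁-1
  a₂ = suc a₂-1
  a₃ = suc a₃-1
  e₁ = side d a₁
  e₂ = side d a₂
  e₃ = side d a₃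
  W₂ = w₂ d a₁ a₂
  W₃ = w₃ d a₁ a₂ a₃

  v≡ : e₁ * e₂ * e₃ ≡ suc (W₃ * d)
  v≡ = alg d a₁ a₂ a₃
    where alg : ∀ d a₁ a₂ a₃ → suc (d * a₁) * suc (d * a₂) * suc (d * a₃) ≡
                suc ((a₁ + a₂ * suc (d * a₁) + a₃ * (suc (d * a₁) * suc (d * a₂))) * d)
          alg = solve-∀

  v-1≡ : e₁ * e₂ * e₃ ∸ 1 ≡ W₃ * d
  v-1≡ = cong (_∸ 1) v≡

  e₁e₂-1≡ : e₁ * e₂ ∸ 1 ≡ W₂ * d
  e₁e₂-1≡ = cong (_∸ 1) (alg d a₁ a₂)
    where alg : ∀ d a₁ a₂ → suc (d * a₁) * suc (d * a₂) ≡ suc ((a₁ + a₂ * suc (d * a₁)) * d)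
          alg = solve-∀

  k-1≡ : k-1 ≡ q * W₃
  k-1≡ = *-cancelʳ-≡ k-1 (q * W₃) d (begin
    k-1 * d        ≡⟨ k-1*d≡ ⟩
    q * (e₁ * e₂ * e₃ ∸ 1) ≡⟨ cong (q *_) v-1≡ ⟩
    q * (W₃ * d)   ≡⟨ sym (*-assoc q W₃ d) ⟩
    q * W₃ * d     ∎)

  q<d : q < d
  q<d = *-cancelʳ-< W₃ q d (subst₂ _<_ k-1≡ (*-comm W₃ d) (s<s⁻¹ (subst (k <_) v≡ k<v)))

  y-formula : ∀ {y b} → e₁ * e₂ * e₃ ∸ 1 + k-1 * (b * d) ≡ y * (e₁ * e₂ * e₃ ∸ 1) → y ≡ suc (q * b)
  y-formula {y} {b} eq = sym (*-cancelʳ-≡ (suc (q * b)) y (W₃ * d) (begin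
    suc (q * b) * (W₃ * d)       ≡⟨ alg q b W₃ d ⟩
    W₃ * d + q * W₃ * (b * d)    ≡⟨ cong₂ (λ s t → s + t * (b * d)) (sym v-1≡) (sym k-1≡) ⟩
    e₁ * e₂ * e₃ ∸ 1 + k-1 * (b * d) ≡⟨ eq ⟩
    y * (e₁ * e₂ * e₃ ∸ 1)       ≡⟨ cong (y *_) v-1≡ ⟩
    y * (W₃ * d)                 ∎))
    where alg : ∀ q b w d → suc (q * b) * (w * d) ≡ w * d + q * w * (b * d)
          alg = solve-∀

  y₁≡′ : y₁ ≡ suc (q * a₁)
  y₁≡′ = y-formula
    (subst (λ z → e₁ * e₂ * e₃ ∸ 1 + k-1 * z ≡ y₁ * (e₁ * e₂ * e₃ ∸ 1)) (*-comm d a₁) y₁≡)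

  y₂≡′ : y₂ ≡ suc (q * W₂)
  y₂≡′ = y-formula
    (subst (λ z → e₁ * e₂ * e₃ ∸ 1 + k-1 * z ≡ y₂ * (e₁ * e₂ * e₃ ∸ 1)) e₁e₂-1≡ y₂≡)

  y₁∣′ : y₁ ∣ a₂ * e₁
  y₁∣′ = *-cancelʳ-∣ d (subst (y₁ * d ∣_) (alg d a₂ e₁) y₁∣)
    where alg : ∀ d a b → d * a * b ≡ a * b * d
          alg = solve-∀

  y₂∣′ : y₂ ∣ a₃ * (e₁ * e₂)
  y₂∣′ = *-cancelʳ-∣ d (subst (y₂ * d ∣_) (alg d a₃ e₁ e₂) y₂∣)
    where alg : ∀ d a b c → d * a * b * c ≡ a * (b * c) * d
          alg = solve-∀

  conclude : ∀ q → k-1 ≡ q * W₃ → q < d → y₁ ≡ suc (q * a₁) → y₂ ≡ suc (q * W₂) →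
    (e₁ , e₂ , e₃ , k) ∈ tuples
  conclude zero    k-1≡ _         _ _ = contradiction k-1≡ (>⇒≢ 0<k-1)
  conclude (suc m) k-1≡ (s≤s m<) y₁≡ y₂≡ = subst (λ z → (e₁ , e₂ , e₃ , suc z) ∈ tuples) (sym k-1≡)
    (listed d< a₁< a₂< m< (subst (_∣ a₂ * e₁) y₁≡ y₁∣′) a₃< (subst (_∣ a₃ * (e₁ * e₂)) y₂≡ y₂∣′))

numeric-listed : ∀ n₁ n₂ n₃ k d y₁ y₂ → .{{_ : NonZero d}} → d ∣ suc n₁ → d ∣ suc n₂ → d ∣ suc n₃ →
  2 + n₁ ≤ 50 → 2 + n₂ ≤ 50 → 2 + n₃ ≤ 50 → 1 < k → k < (2 + n₁) * (2 + n₂) * (2 + n₃) →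
  NumericConditions (2 + n₁) (2 + n₂) (2 + n₃) k d y₁ y₂ → (2 + n₁ , 2 + n₂ , 2 + n₃ , k) ∈ tuples
numeric-listed n₁ n₂ n₃ k d@(suc d-1) y₁ y₂
  -- The quotients are positive because each `eᵢ - 1` is.
  (divides (suc a₁) eq₁) (divides (suc a₂) eq₂) (divides (suc a₃) eq₃)
  (s≤s n₁≤) (s≤s n₂≤) (s≤s n₃≤) 1<k = substituted (eq-e eq₁) (eq-e eq₂) (eq-e eq₃) d≤
      (bound eq₁ n₁≤) (bound eq₂ n₂≤) (bound eq₃ n₃≤)
  where
  eq-e : ∀ {n a} → suc n ≡ a * d → 2 + n ≡ side d a
  eq-e {n} {a} eq = cong suc (trans eq (*-comm a d))
  d≤ : d ≤ 49
  d≤ = ≤-trans (∣⇒≤ (divides (suc a₁) eq₁)) n₁≤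
  bound : ∀ {n a} → suc n ≡ a * d → suc n ≤ 49 → a ≤ 49 / d
  bound {n} {a} eq n≤ = subst (_≤ 49 / d) (m*n/n≡m a d) (/-monoˡ-≤ d (subst (_≤ 49) eq n≤))
  -- The sides are generalised to variables so that their equations can be matched with `refl`.
  substituted : ∀ {E₁ E₂ E₃} → E₁ ≡ side d (suc a₁) → E₂ ≡ side d (suc a₂) → E₃ ≡ side d (suc a₃) →
    d-1 < 49 → a₁ < 49 / d → a₂ < 49 / d → a₃ < 49 / d →
    k < E₁ * E₂ * E₃ → NumericConditions E₁ E₂ E₃ k d y₁ y₂ → (E₁ , E₂ , E₃ , k) ∈ tuples
  substituted refl refl refl d< a₁< a₂< a₃< = reduced-listed d-1 a₁ a₂ a₃ k y₁ y₂ d< a₁< a₂< a₃< 1<k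

-- Numerical verification of the listed tuples

record Admissible (n₁ n₂ n₃ k x₁ x₂ x₃ : ℕ) : Set where
  constructor admissible
  field
    conditions : NumericConditions (2 + n₁) (2 + n₂) (2 + n₃) k
                   (gcd (suc n₁) (gcd (suc n₂) (suc n₃))) (2 + x₁) ((2 + x₁) * (2 + x₂))
    k-eq : k ≡ (2 + x₁) * (2 + x₂) * (2 + x₃)
    x₁≤n₁ : x₁ ≤ n₁
    x₂≤n₂ : x₂ ≤ n₂
    x₃≤n₃ : x₃ ≤ n₃
    proportion₂ : suc x₁ * suc n₂ * (2 + n₁) ≡ suc x₂ * (2 + x₁) * suc n₁
    proportion₃ : (suc x₁ + (2 + x₁) * suc x₂) * suc n₃ * suc (suc n₁ + (2 + n₁) * suc n₂) ≡
                  suc x₃ * suc (suc x₁ + (2 + x₁) * suc x₂) * (suc n₁ + (2 + n₁) * suc n₂)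

admissible? : ∀ n₁ n₂ n₃ k x₁ x₂ x₃ → Dec (Admissible n₁ n₂ n₃ k x₁ x₂ x₃)
admissible? n₁ n₂ n₃ k x₁ x₂ x₃ = map′
  (λ (c , p , q , r , s , t , u) → admissible c p q r s t u)
  (λ (admissible c p q r s t u) → c , p , q , r , s , t , u)
  (numericConditions? (2 + n₁) (2 + n₂) (2 + n₃) k (gcd (suc n₁) (gcd (suc n₂) (suc n₃)))
     (2 + x₁) ((2 + x₁) * (2 + x₂)) ×-dec
   (_ ≟ _) ×-dec (_ ≤? _) ×-dec (_ ≤? _) ×-dec (_ ≤? _) ×-dec (_ ≟ _) ×-dec (_ ≟ _))

-- The xᵢ - 2 read off from the definition of the yᵢ; as v ≥ 2, the divisor suc (v ∸ 2) is v - 1.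
x-2 : (e₁ e₂ e₃ k : ℕ) → ℕ × ℕ × ℕ
x-2 e₁ e₂ e₃ k = y₁ ∸ 2 , y₂ / y₁ ∸ 2 , k / y₂ ∸ 2
  where
  y₁ = suc ((k ∸ 1) * (e₁ ∸ 1) / suc (e₁ * e₂ * e₃ ∸ 2))
  y₂ = suc ((k ∸ 1) * (e₁ * e₂ ∸ 1) / suc (e₁ * e₂ * e₃ ∸ 2))

ListedAdmissible : ℕ × ℕ × ℕ × ℕ → Set
ListedAdmissible (e₁ , e₂ , e₃ , k) =
  let x₁ , x₂ , x₃ = x-2 e₁ e₂ e₃ k in Admissible (e₁ ∸ 2) (e₂ ∸ 2) (e₃ ∸ 2) k x₁ x₂ x₃

-- All hypotheses of the geometric construction are decidable statements about natural numbers, so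
-- the converse reduces to an evaluation over the list.
tuples-admissible : All ListedAdmissible tuples
tuples-admissible = toWitness {a? = All.all? {P = ListedAdmissible} (λ (e₁ , e₂ , e₃ , k) →
  let x₁ , x₂ , x₃ = x-2 e₁ e₂ e₃ k in admissible? (e₁ ∸ 2) (e₂ ∸ 2) (e₃ ∸ 2) k x₁ x₂ x₃) tuples} tt

-- Translation of the conditions and assembly of both directions

module _ (n₁ n₂ n₃ k : ℕ) (2≤e₁ : 2 ≤ 2 + n₁) (2≤e₂ : 2 ≤ 2 + n₂) (2≤e₃ : 2 ≤ 2 + n₃) where
  open Parameters (2 + n₁) (2 + n₂) (2 + n₃) k 2≤e₁ 2≤e₂ 2≤e₃

  private
    v-1 : ℕ
    v-1 = (2 + n₁) * (2 + n₂) * (2 + n₃) ∸ 1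

    instance
      d≢0′ : NonZero d
      d≢0′ = ≢-nonZero (gcd[m,n]≢0 (suc n₁) (gcd (suc n₂) (suc n₃)) (inj₁ λ ()))

    d∣₁ : d ∣ suc n₁
    d∣₁ = gcd[m,n]∣m (suc n₁) (gcd (suc n₂) (suc n₃))
    d∣₂ : d ∣ suc n₂
    d∣₂ = ∣-trans (gcd[m,n]∣n (suc n₁) (gcd (suc n₂) (suc n₃))) (gcd[m,n]∣m (suc n₂) (suc n₃))
    d∣₃ : d ∣ suc n₃
    d∣₃ = ∣-trans (gcd[m,n]∣n (suc n₁) (gcd (suc n₂) (suc n₃))) (gcd[m,n]∣n (suc n₂) (suc n₃))

  Conditions⇒Numeric : Conditions →
    ∃[ y₁ ] ∃[ y₂ ] NumericConditions (2 + n₁) (2 + n₂) (2 + n₃) k d y₁ y₂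
  Conditions⇒Numeric c with Conditions.condition₂ c | Conditions.condition₃ c
  ... | z₁ , y₁≡z₁ , z₁∣ | z₂ , y₂≡z₂ , z₂∣ =
    -- Absolute values turn the integers into naturals: the other sides of the equations are
    -- nonnegative, and integer divisibility is divisibility of absolute values.
    ℤ.∣ z₁ ∣ , ℤ.∣ z₂ ∣ , numeric (Conditions.condition₁ c)
    (trans (cong ℤ.∣_∣ (⇒ (1+m/n*o≡z⇔ (k ∸ 1) v-1 (suc n₁) z₁) y₁≡z₁)) (ℤ.abs-* z₁ (+ v-1)))
    (trans (cong ℤ.∣_∣ (⇒ (1+m/n*o≡z⇔ (k ∸ 1) v-1 ((2 + n₁) * (2 + n₂) ∸ 1) z₂) y₂≡z₂))
           (ℤ.abs-* z₂ (+ v-1)))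
    -- The division by `d` is exact because `d` divides e₂ - 1, and in the next line e₃ - 1.
    (m∣n/o⇒m*o∣n (∣m⇒∣m*n (2 + n₁) d∣₂) z₁∣)
    (m∣n/o⇒m*o∣n (∣m⇒∣m*n (2 + n₂) (∣m⇒∣m*n (2 + n₁) d∣₃)) z₂∣)

  module _ {y₁ y₂ : ℕ} (num : NumericConditions (2 + n₁) (2 + n₂) (2 + n₃) k d y₁ y₂) where
    open NumericConditions num using (v-1∣; y₁-eq; y₂-eq; y₁∣; y₂∣)
    y₁-value : y (suc zero) ≡ + y₁ ℚ./ 1
    y₁-value = ⇐ (1+m/n*o≡z⇔ (k ∸ 1) v-1 (suc n₁) (+ y₁))
      (trans (cong +_ y₁-eq) (ℤ.pos-* y₁ v-1))

    y₂-value : y (suc (suc zero)) ≡ + y₂ ℚ./ 1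
    y₂-value = ⇐ (1+m/n*o≡z⇔ (k ∸ 1) v-1 ((2 + n₁) * (2 + n₂) ∸ 1) (+ y₂))
      (trans (cong +_ y₂-eq) (ℤ.pos-* y₂ v-1))

    Numeric⇒Conditions : Conditions
    Numeric⇒Conditions = record
      { condition₁ = v-1∣
      ; condition₂ = + y₁ , y₁-value , m*n∣o⇒m∣o/n y₁ d y₁∣
      ; condition₃ = + y₂ , y₂-value , m*n∣o⇒m∣o/n y₂ d y₂∣
      }

  module _ {x₁ x₂ x₃ : ℕ}
    (num : NumericConditions (2 + n₁) (2 + n₂) (2 + n₃) k d (2 + x₁) ((2 + x₁) * (2 + x₂)))
    (k≡ : k ≡ (2 + x₁) * (2 + x₂) * (2 + x₃)) where
    open Geometry n₁ n₂ n₃ x₁ x₂ x₃ k 2≤e₁ 2≤e₂ 2≤e₃ using (Box)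

    ratio₁ : ratio zero ≡ + (2 + x₁) ℚ./ 1
    ratio₁ = quotient-of-integers (2 + x₁) 1 (2 + x₁) (y₁-value num) refl (sym (*-identityˡ (2 + x₁)))

    ratio₂ : ratio (suc zero) ≡ + (2 + x₂) ℚ./ 1
    ratio₂ = quotient-of-integers ((2 + x₁) * (2 + x₂)) (2 + x₁) (2 + x₂)
      (y₂-value num) (y₁-value num) refl

    ratio₃ : ratio (suc (suc zero)) ≡ + (2 + x₃) ℚ./ 1
    ratio₃ = quotient-of-integers k ((2 + x₁) * (2 + x₂)) (2 + x₃) refl (y₂-value num) k≡

    below⇔ : ∀ i x {q} → q ≡ + suc x ℚ./ 1 → (+ i ℚ./ 1) ℚ.≤ q ℚ.- ℚ.1ℚ ⇔ i < suc x
    below⇔ i x refl = i/1≤x/1-1⇔ i x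

    B≐Box : B ≐ Box
    B≐Box =
      (λ {(a , b , c)} p →
        ⇒ (below⇔ (toℕ a) (suc x₁) ratio₁) (p zero) ,
        ⇒ (below⇔ (toℕ b) (suc x₂) ratio₂) (p (suc zero)) ,
        ⇒ (below⇔ (toℕ c) (suc x₃) ratio₃) (p (suc (suc zero)))) ,
      (λ { {a , b , c} (p₁ , p₂ , p₃) zero → ⇐ (below⇔ (toℕ a) (suc x₁) ratio₁) p₁
         ; {a , b , c} (p₁ , p₂ , p₃) (suc zero) → ⇐ (below⇔ (toℕ b) (suc x₂) ratio₂) p₂
         ; {a , b , c} (p₁ , p₂ , p₃) (suc (suc zero)) → ⇐ (below⇔ (toℕ c) (suc x₃) ratio₃) p₃ })

  Conditions⇒listed : 2 + n₁ ≤ 50 → 2 + n₂ ≤ 50 → 2 + n₃ ≤ 50 →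
    1 < k → k < (2 + n₁) * (2 + n₂) * (2 + n₃) → Conditions → (2 + n₁ , 2 + n₂ , 2 + n₃ , k) ∈ tuples
  Conditions⇒listed e₁≤50 e₂≤50 e₃≤50 1<k k<v c = let y₁ , y₂ , num = Conditions⇒Numeric c in
    numeric-listed n₁ n₂ n₃ k d y₁ y₂ d∣₁ d∣₂ d∣₃ e₁≤50 e₂≤50 e₃≤50 1<k k<v num

  Admissible⇒ : ∀ {x₁ x₂ x₃} → Admissible n₁ n₂ n₃ k x₁ x₂ x₃ →
    Conditions × Is2Design 𝒟ᶠᵗ × IsFlagTransitiveChainImprimitive 𝒟ᶠᵗ G 𝒞
  Admissible⇒ {x₁} {x₂} {x₃} (admissible num k≡ x₁≤ x₂≤ x₃≤ proportion₂ proportion₃) =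
    Numeric⇒Conditions num ,
    2-design (B≐Box num k≡) x₁≤ x₂≤ x₃≤ proportion₂ proportion₃ ,
    chain-imprimitive (B≐Box num k≡) x₁≤ x₂≤ x₃≤
    where open Geometry n₁ n₂ n₃ x₁ x₂ x₃ k 2≤e₁ 2≤e₂ 2≤e₃

theorem6p3 : ∀ (e₁ e₂ e₃ k : ℕ)
    (2≤e₁ : 2 ≤ e₁) (2≤e₂ : 2 ≤ e₂) (2≤e₃ : 2 ≤ e₃) →
    e₁ ≤ 50 → e₂ ≤ 50 → e₃ ≤ 50 →
    1 < k → k < e₁ * e₂ * e₃ →
    let open Parameters e₁ e₂ e₃ k 2≤e₁ 2≤e₂ 2≤e₃ in
    (Conditions × Is2Design 𝒟ᶠᵗ × IsFlagTransitiveChainImprimitive 𝒟ᶠᵗ G 𝒞)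
    ⇔ (e₁ , e₂ , e₃ , k) ∈ tuples
theorem6p3 _ _ _ k
  -- Matching on the lower bounds turns `eᵢ` into `2 + nᵢ`, so the terms `eᵢ ∸ 2` in
  -- `ListedAdmissible` compute to `nᵢ`.
  2≤e₁@(s≤s (s≤s {n = n₁} z≤n)) 2≤e₂@(s≤s (s≤s {n = n₂} z≤n)) 2≤e₃@(s≤s (s≤s {n = n₃} z≤n))
  e₁≤50 e₂≤50 e₃≤50 1<k k<v = mk⇔
  (λ (c , _) → Conditions⇒listed n₁ n₂ n₃ k 2≤e₁ 2≤e₂ 2≤e₃ e₁≤50 e₂≤50 e₃≤50 1<k k<v c)
  (λ t∈ → Admissible⇒ n₁ n₂ n₃ k 2≤e₁ 2≤e₂ 2≤e₃ (All.lookup tuples-admissible t∈))
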